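{- The algorithm SMB for dynamic square bin packing has an asymptotic competitive ratio of at most $\frac{4811105}{1433976}\approx 3.356$ when all items are unit-fraction squares. That is, there is an absolute constant $b$ such that $\mathrm{SMB}(\sigma)\le \frac{4811105}{1433976}\,\mathrm{OPT}(\sigma)+b$ for every input sequence $\sigma$ of arrivals and departures of unit-fraction squares.
   Context: A unit-fraction square is a square of side $\frac1k$ for some integer $k\ge1$. **Model.** Items are squares of side in $(0,1]$; a bin is a unit square. An input $\sigma$ is a finite sequence of arrivals and departures of squares. An arriving item must be immediately packed (without overlap) into a bin; a departing item (one currently present) is removed from its bin. The online algorithm does not know future arrivals or departures. When an item is placed in a bin, the items currently in that same bin may be rearranged within it; items never move between bins, and no repacking takes place at departures. A bin is active at a moment if it contains at least one item at that moment. $\mathrm{OPT}(\sigma)$ is the maximum number, over all moments, of active bins used by an optimal offline algorithm, which knows $\sigma$ in advance and may rearrange items arbitrarily across all bins at any time. For an online algorithm $\mathcal A$, $\mathcal A(\sigma)$ is the maximum number of active bins used by $\mathcal A$ at any moment. $\mathcal A$ has asymptotic competitive ratio $c$ (on a class of inputs) if there is an absolute constant $b$ with $\mathcal A(\sigma)\le c\cdot \mathrm{OPT}(\sigma)+b$ for all $\sigma$ in the class. **NFDH (Next-Fit Decreasing Height).** Given a finite multiset of squares, sort them by non-increasing side. Pack them in this order side by side, from the left, along the bottom of a strip of width $1$ (forming a level) until the next square does not fit horizontally (i.e. the sum of the sides in the level would exceed $1$). Then close that level and start a new level, with this square as its first item, on the horizontal line through the top of the first (tallest) square of the closed level; continue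 in the same way. The height of a level is the side of its first square. NFDH packs the multiset into a bin (succeeds) if the heights of all levels sum to at most $1$; otherwise it fails. "Packing a square $s$ into bin $B$ with NFDH" means applying NFDH to the multiset consisting of $s$ together with the squares currently in $B$. **Size classes.** A square is small if its side is at most $\frac13$, medium if its side is in $(\frac13,\frac12]$, big if its side is larger than $\frac12$. **Algorithm SM** (input: arrivals/departures of squares of side at most $\frac12$). Maintain two classes of bins $\mathcal S$ and $\mathcal M$, initially empty; bins stay in the classes even if they become empty. Process events in order: - If $s$ departs, remove $s$ from its bin. - If a small $s$ arrives: if possible, pack $s$ with NFDH into a bin $B\in\mathcal S\cup\mathcal M$, giving priority to bins of $\mathcal S$ (a bin of $\mathcal M$ is used only if NFDH fails for every bin of $\mathcal S$); if $B\in\mathcal M$, move $B$ from $\mathcal M$ to $\mathcal S$. If NFDH fails for all bins of $\mathcal S\cup\mathcal M$, open a new bin $B$, pack $s$ into it and add $B$ to $\mathcal S$. - If a medium $s$ arrives: if possible, pack $s$ with NFDH into a bin of $\mathcal M\cup\mathcal S$, giving priority to bins of $\mathcal M$ (class memberships do not change). If this is not possible, open a new bin $B$, pack $s$ into it and add $B$ to $\mathcal M$. The choice among eligible bins of the same class is otherwise arbitrary. **Algorithm SMB** (input: arrivals/departures of squares of side at most $1$). Partition the input online into the subsequence $L_1$ of small and medium squares and the subsequence $L_2$ of big squares, which use disjoint sets of bins. Apply SM to $L_1$. For $L_2$, maintain a set $\mathcal B$ of bins, initially empty; pack each arriving big square into an empty bin of $\mathcal B$ if one exists, and otherwise into a new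 bin which is added to $\mathcal B$.
   Formalization: In OPT, the offline algorithm places squares at rational rather than real coordinates; OPT is unchanged, since the packing constraints are linear inequalities with rational coefficients and so solvable over the reals exactly when over the rationals. -}

module Defs where

open import Data.Fin using (Fin)
open import Data.Integer using (+_)
open import Data.List using (List; []; _∷_; [_]; length; map; filter; foldl; foldr; inits; lookup; removeAt; deduplicate; tabulate; _[_]%=_)
open import Data.List.Membership.Propositional using (_∈_)
open import Data.List.NonEmpty using (List⁺; _∷_; _⁺∷ʳ_; head; toList)
open import Data.List.Relation.Unary.All using (All; reduce)
open import Data.List.Sort.InsertionSort using (sort)
open import Data.Nat using (ℕ; suc; _⊔_) renaming (_+_ to _+ℕ_; _≤_ to _≤ℕ_; _≟_ to _≟ℕ_)
open import Data.Product using (Σ-syntax; ∃-syntax; _×_; _,_)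
open import Data.Rational using (ℚ; 0ℚ; 1ℚ; _+_; _≤_; _<_; _≤?_; _/_)
open import Data.Rational.Properties using (≤-decTotalOrder)
open import Data.Sum using (_⊎_)
open import Function using (_∘_)
open import Relation.Binary.Properties.DecTotalOrder ≤-decTotalOrder using (≥-decTotalOrder)
open import Relation.Binary.PropositionalEquality using (_≡_; _≢_)
open import Relation.Nullary using (¬_; ¬?; yes; no)

-- The label tells apart different items of equal side.
record Item : Set where
  constructor item
  field
    label : ℕ
    side  : ℚ

open Item public

data Event : Set where
  arrive depart : Item → Event

subject : Event → Item
subject (arrive s) = s
subject (depart s) = s

remove : Item → List Item → List Item
remove s = filter (λ t → ¬? (label t ≟ℕ label s))

update : List Item → Event → List Item
update P (arrive s) = s ∷ P
update P (depart s) = remove s P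

present : List Event → List Item
present = foldl update []

-- ValidFrom P σ: σ is a legal continuation when the items in P are present.
data ValidFrom (P : List Item) : List Event → Set where
  []     : ValidFrom P []
  arrive : ∀ {s σ} → 0ℚ < side s → side s ≤ 1ℚ →
           All (λ t → label t ≢ label s) P →
           ValidFrom (update P (arrive s)) σ → ValidFrom P (arrive s ∷ σ)
  depart : ∀ {s σ} → s ∈ P →
           ValidFrom (update P (depart s)) σ → ValidFrom P (depart s ∷ σ)

Valid : List Event → Set
Valid = ValidFrom []

UnitFraction : ℚ → Set
UnitFraction q = ∃[ k ] q ≡ + 1 / suc k

UnitFractionInput : List Event → Set
UnitFractionInput = All (UnitFraction ∘ side ∘ subject)

Disjoint : (x y a x′ y′ a′ : ℚ) → Set
Disjoint x y a x′ y′ a′ = x + a ≤ x′ ⊎ x′ + a′ ≤ x ⊎ y + a ≤ y′ ⊎ y′ + a′ ≤ y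

-- (x i , y i) is the lower left corner of the i-th square in bin number
-- bin i.  Squares are axis-parallel and may touch along their boundaries.
-- Rational corners are as general as real ones: for rational sides and a
-- fixed choice of disjuncts in Disjoint, the constraints are linear
-- inequalities with rational coefficients.
record Packing (P : List Item) : Set where
  a : Fin (length P) → ℚ
  a i = side (lookup P i)
  field
    bin      : Fin (length P) → ℕ
    x y      : Fin (length P) → ℚ
    inside   : ∀ i → (0ℚ ≤ x i × x i + a i ≤ 1ℚ) × (0ℚ ≤ y i × y i + a i ≤ 1ℚ)
    disjoint : ∀ i j → i ≢ j → bin i ≡ bin j →
               Disjoint (x i) (y i) (a i) (x j) (y j) (a j)

  activeBins : ℕ
  activeBins = length (deduplicate _≟ℕ_ (tabulate bin))

-- An offline solution chooses a new packing of all present items at every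
-- moment; the moments correspond to the prefixes of the input.
Offline : List Event → Set
Offline σ = All (Packing ∘ present) (inits σ)

offlineCost : ∀ {σ} → Offline σ → ℕ
offlineCost = foldr _⊔_ 0 ∘ reduce Packing.activeBins

IsOPT : List Event → ℕ → Set
IsOPT σ m = (Σ[ p ∈ Offline σ ] offlineCost p ≡ m) × (∀ (p : Offline σ) → m ≤ℕ offlineCost p)

sum : List ℚ → ℚ
sum = foldr _+_ 0ℚ

-- The first argument is the currently open level, from left to right.
nextFit : List⁺ ℚ → List ℚ → List (List⁺ ℚ)
nextFit L []       = [ L ]
nextFit L (q ∷ qs) with sum (toList L) + q ≤? 1ℚ
... | yes _ = nextFit (L ⁺∷ʳ q) qs
... | no  _ = L ∷ nextFit (q ∷ []) qs

levelsOfSorted : List ℚ → List (List⁺ ℚ)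
levelsOfSorted []       = []
levelsOfSorted (q ∷ qs) = nextFit (q ∷ []) qs

levels : List ℚ → List (List⁺ ℚ)
levels = levelsOfSorted ∘ sort ≥-decTotalOrder

-- Only the sides matter, and ties in the sorting are immaterial.
NFDH : List Item → Set
NFDH B = sum (map head (levels (map side B))) ≤ 1ℚ

Small Medium Big : Item → Set
Small  s = side s ≤ + 1 / 3
Medium s = + 1 / 3 < side s × side s ≤ + 1 / 2
Big    s = + 1 / 2 < side s

-- NFDH repacks the whole bin at each arrival, so only the content of a bin
-- matters and not the positions of the items in it.
Bin : Set
Bin = List Item

NoFit : Item → List Bin → Set
NoFit s = All (λ B → ¬ NFDH (s ∷ B))

record SMState : Set where
  constructor ⟨_,_⟩
  field
    𝒮 ℳ : List Bin

-- A relation, since the choice among eligible bins is arbitrary.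
data SMStep : SMState → Event → SMState → Set where
  departs    : ∀ {S M s} →
               SMStep ⟨ S , M ⟩ (depart s) ⟨ map (remove s) S , map (remove s) M ⟩
  small-in-S : ∀ {S M s} → Small s →
               (i : Fin (length S)) → NFDH (s ∷ lookup S i) →
               SMStep ⟨ S , M ⟩ (arrive s) ⟨ S [ i ]%= (s ∷_) , M ⟩
  small-in-M : ∀ {S M s} → Small s → NoFit s S →
               (i : Fin (length M)) → NFDH (s ∷ lookup M i) →
               SMStep ⟨ S , M ⟩ (arrive s) ⟨ (s ∷ lookup M i) ∷ S , removeAt M i ⟩
  small-new  : ∀ {S M s} → Small s → NoFit s S → NoFit s M →
               SMStep ⟨ S , M ⟩ (arrive s) ⟨ [ s ] ∷ S , M ⟩
  med-in-M   : ∀ {S M s} → Medium s →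
               (i : Fin (length M)) → NFDH (s ∷ lookup M i) →
               SMStep ⟨ S , M ⟩ (arrive s) ⟨ S , M [ i ]%= (s ∷_) ⟩
  med-in-S   : ∀ {S M s} → Medium s → NoFit s M →
               (i : Fin (length S)) → NFDH (s ∷ lookup S i) →
               SMStep ⟨ S , M ⟩ (arrive s) ⟨ S [ i ]%= (s ∷_) , M ⟩
  med-new    : ∀ {S M s} → Medium s → NoFit s M → NoFit s S →
               SMStep ⟨ S , M ⟩ (arrive s) ⟨ S , [ s ] ∷ M ⟩

data BigStep : List Bin → Event → List Bin → Set where
  departs  : ∀ {ℬ s} → BigStep ℬ (depart s) (map (remove s) ℬ)
  in-empty : ∀ {ℬ s} (i : Fin (length ℬ)) → lookup ℬ i ≡ [] →
             BigStep ℬ (arrive s) (ℬ [ i ]%= (s ∷_))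
  new      : ∀ {ℬ s} → All (_≢ []) ℬ → BigStep ℬ (arrive s) ([ s ] ∷ ℬ)

record SMBState : Set where
  constructor _∣_
  field
    sm : SMState
    ℬ  : List Bin

initial : SMBState
initial = ⟨ [] , [] ⟩ ∣ []

data SMBStep : SMBState → Event → SMBState → Set where
  L₁ : ∀ {X X′ ℬ e} → ¬ Big (subject e) → SMStep X e X′ → SMBStep (X ∣ ℬ) e (X′ ∣ ℬ)
  L₂ : ∀ {X ℬ ℬ′ e} → Big (subject e) → BigStep ℬ e ℬ′ → SMBStep (X ∣ ℬ) e (X ∣ ℬ′)

nonempty : List Bin → ℕ
nonempty []             = 0
nonempty ([] ∷ Bs)      = nonempty Bs
nonempty ((_ ∷ _) ∷ Bs) = suc (nonempty Bs)

active : SMBState → ℕ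
active (⟨ S , M ⟩ ∣ ℬ) = nonempty S +ℕ nonempty M +ℕ nonempty ℬ

infixr 5 _∷_

data RunFrom (X : SMBState) : List Event → Set where
  []  : RunFrom X []
  _∷_ : ∀ {e Y σ} → SMBStep X e Y → RunFrom Y σ → RunFrom X (e ∷ σ)

peak : ∀ {X σ} → RunFrom X σ → ℕ
peak {X} []      = active X
peak {X} (_ ∷ r) = active X ⊔ peak r

SMBRun : List Event → Set
SMBRun = RunFrom initial

{-# OPTIONS --safe #-}

-- If NFDH fails on unit-fraction squares of side at most 1/2, their total area
-- is at least 7/12: the squares of a level of height h after its first one,
-- together with the first square of the next level, of side q, have total width
-- more than 1 - h and sides at least q, hence area at least (1 - h) q.  Summing
-- over the levels and inspecting the possible first two heights gives 7/12.
--
-- Hence an 𝒮-bin has area at least 7/12 - 1/9 = 17/36 when it rejects a small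
-- square and 7/12 - 1/4 = 1/3 when it rejects a medium one, while an ℳ-bin
-- contains only squares of side 1/2 and is full when it rejects anything.
-- Comparing areas with m = OPT whenever a bin is opened or moved bounds |𝒮| by
-- (36/17) m and |𝒮| + |ℳ| by (41/17) m, up to constants.  Among the active bins
-- at any moment, k in ℳ and b in ℬ satisfy k/4 + b ≤ m, so there are at most
-- |𝒮| + (3/4) |ℳ| + m = (1/4) |𝒮| + (3/4) (|𝒮| + |ℳ|) + m ≤ (227/68) m of them.
module Submission where

open import Defs
import Algebra.Properties.Semiring.Sum as Sum
open import Data.Fin using (Fin; zero; suc; toℕ)
open import Data.Fin.Properties using (toℕ<n; toℕ-injective)
open import Data.Integer using (+_)
import Data.Integer as ℤ
import Data.Integer.Properties as ℤ
open import Data.List using (List; []; _∷_; _++_; _∷ʳ_; length; map; concat; foldl; foldr; inits; lookup; removeAt; tabulate; deduplicate; _[_]%=_)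
open import Data.List.Membership.Propositional using (_∈_)
open import Data.List.Membership.Propositional.Properties using (∈-deduplicate⁺; ∈-tabulate⁺; ∈-lookup)
open import Data.List.NonEmpty using (List⁺; _∷_; head)
open import Data.List.Properties using (map-++; length-map; filter-all; filter-++; length-%=; length-removeAt′)
open import Data.List.Relation.Binary.Permutation.Propositional as ↭ using (_↭_; refl; prep; swap; ↭-refl; ↭-sym; ↭-trans; ↭-reflexive)
open import Data.List.Relation.Binary.Permutation.Propositional.Properties using (All-resp-↭; map⁺; ↭-length; filter-↭; shift; ++⁺ˡ; ++⁺ʳ; ++-comm; ++-assoc)
open import Data.List.Relation.Unary.All as All using (All; []; _∷_; reduce)
open import Data.List.Relation.Unary.All.Properties as All using (∷ʳ⁺; ++⁻ˡ; ++⁻ʳ; concat⁺; map⁻)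
open import Data.List.Relation.Unary.AllPairs using (AllPairs; []; _∷_)
import Data.List.Relation.Unary.AllPairs.Properties as AllPairs
open import Data.List.Relation.Unary.Any using (here; there; index)
open import Data.List.Relation.Unary.Any.Properties using (lookup-index)
open import Data.List.Relation.Unary.Linked.Properties using (Linked⇒AllPairs)
open import Data.List.Sort.Base using (module SortingAlgorithm)
open import Data.List.Sort.InsertionSort using (sort; insertionSort)
open import Data.Nat using (ℕ; zero; suc; z≤n; s≤s)
import Data.Nat as ℕ
open import Data.Nat.Coprimality as Coprime using (1-coprimeTo)
import Data.Nat.Properties as ℕ
open import Data.Product using (∃-syntax; _×_; _,_; proj₁; proj₂)
open import Data.Rational using (ℚ; mkℚ; 0ℚ; 1ℚ; ½; _+_; _*_; _-_; -_; _≤_; _<_; _≥_; _≤?_; _<?_; _/_; *≤*; toℚᵘ; nonNegative)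
open import Data.Rational.Properties
open import Data.Rational.Solver using (module +-*-Solver)
import Data.Rational.Unnormalised as ℚᵘ
import Data.Rational.Unnormalised.Properties as ℚᵘ
open import Data.Sum using (_⊎_; inj₁; inj₂)
open import Data.Unit using (tt)
open import Function using (_∘_)
open import Relation.Binary.Properties.DecTotalOrder ≤-decTotalOrder using (≥-decTotalOrder)
open import Relation.Binary.PropositionalEquality using (_≡_; _≢_; refl; sym; trans; cong; cong₂; subst; subst₂)
open import Relation.Nullary using (¬_; ¬?; yes; no; contradiction)
open import Relation.Nullary.Decidable using (True; toWitness; from-no)
open Sum ℕ.+-*-semiring using (∑-comm; *-distribʳ-sum) renaming (sum to ∑; sum-cong-≗ to ∑-cong)
open +-*-Solver using (solve; _:+_; _:*_; _:-_; _:=_; con)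

-- Inequalities of rationals and the embedding of the naturals.

p≤p+r : ∀ {p q r} → 0ℚ ≤ r → p + r ≡ q → p ≤ q
p≤p+r {p} {q} {r} 0≤r refl = begin
  p      ≡⟨ +-identityʳ p ⟨
  p + 0ℚ ≤⟨ +-monoʳ-≤ p 0≤r ⟩
  p + r  ∎
  where open ≤-Reasoning

p≤q⇒0≤q-p : ∀ {p q} → p ≤ q → 0ℚ ≤ q - p
p≤q⇒0≤q-p {p} {q} p≤q = begin
  0ℚ    ≡⟨ +-inverseʳ p ⟨
  p - p ≤⟨ +-monoˡ-≤ (- p) p≤q ⟩
  q - p ∎
  where open ≤-Reasoning

+-nonNeg : ∀ {p q} → 0ℚ ≤ p → 0ℚ ≤ q → 0ℚ ≤ p + q
+-nonNeg 0≤p 0≤q = +-mono-≤ 0≤p 0≤q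

*-nonNeg : ∀ {p q} → 0ℚ ≤ p → 0ℚ ≤ q → 0ℚ ≤ p * q
*-nonNeg {p} {q} 0≤p 0≤q = begin
  0ℚ     ≡⟨ *-zeroʳ p ⟨
  p * 0ℚ ≤⟨ *-monoˡ-≤-nonNeg p {{nonNegative 0≤p}} 0≤q ⟩
  p * q  ∎
  where open ≤-Reasoning

≤-dec : ∀ p q {_ : True (p ≤? q)} → p ≤ q
≤-dec p q {t} = toWitness t

ι : ℕ → ℚ
ι n = + n / 1

-- `+ n / 1` normalises through a gcd that does not reduce for a variable `n`. Rewriting it to an
-- explicit `mkℚ` lets the arithmetic and the order on `ℚ` compute.
ι-mkℚ : ∀ n → ι n ≡ mkℚ (+ n) 0 (Coprime.sym (1-coprimeTo n))
ι-mkℚ n = normalize-coprime (Coprime.sym (1-coprimeTo n))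

ι-+ : ∀ m n → ι (m ℕ.+ n) ≡ ι m + ι n
ι-+ m n rewrite ι-mkℚ m | ι-mkℚ n =
  sym (cong (_/ 1) (cong₂ ℤ._+_ (ℤ.*-identityʳ (+ m)) (ℤ.*-identityʳ (+ n))))

ι-* : ∀ m n → ι (m ℕ.* n) ≡ ι m * ι n
ι-* m n rewrite ι-mkℚ m | ι-mkℚ n = cong (_/ 1) (ℤ.pos-* m n)

ι-mono-≤ : ∀ {m n} → m ℕ.≤ n → ι m ≤ ι n
ι-mono-≤ {m} {n} m≤n rewrite ι-mkℚ m | ι-mkℚ n = *≤* (ℤ.*-monoʳ-≤-nonNeg (+ 1) (ℤ.+≤+ m≤n))

ι-cancel-≤ : ∀ {m n} → ι m ≤ ι n → m ℕ.≤ n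
ι-cancel-≤ {m} {n} le rewrite ι-mkℚ m | ι-mkℚ n =
  ℤ.drop‿+≤+ (ℤ.*-cancelʳ-≤-pos (+ m) (+ n) (+ 1) (drop-*≤* le))

0≤ι : ∀ n → 0ℚ ≤ ι n
0≤ι n = nonNegative⁻¹ (ι n) {{normalize-nonNeg n 1}}

ι-suc : ∀ n → ι (suc n) ≡ 1ℚ + ι n
ι-suc = ι-+ 1

-- Areas of bins on which NFDH fails

sumsq : List ℚ → ℚ
sumsq = sum ∘ map (λ a → a * a)

sum-++ : ∀ xs {ys} → sum (xs ++ ys) ≡ sum xs + sum ys
sum-++ []       = sym (+-identityˡ _)
sum-++ (x ∷ xs) = trans (cong (_+_ x) (sum-++ xs)) (sym (+-assoc x _ _))

sumsq-++ : ∀ xs {ys} → sumsq (xs ++ ys) ≡ sumsq xs + sumsq ys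
sumsq-++ xs {ys} = trans (cong sum (map-++ _ xs ys)) (sum-++ (map _ xs))

sumsq-∷ʳ : ∀ F qs {q} → sumsq (F ∷ʳ q) + sumsq qs ≡ sumsq F + sumsq (q ∷ qs)
sumsq-∷ʳ F qs {q} = trans (cong (_+ sumsq qs) (sumsq-++ F))
  (solve 3 (λ a b c → (a :+ (b :+ con 0ℚ)) :+ c := a :+ (b :+ c)) refl (sumsq F) (q * q) (sumsq qs))

sumsq-↭ : ∀ {xs ys} → xs ↭ ys → sumsq xs ≡ sumsq ys
sumsq-↭ refl                            = refl
sumsq-↭ (prep x p)                      = cong (_+_ (x * x)) (sumsq-↭ p)
sumsq-↭ (swap x y p) = trans (cong (λ t → x * x + (y * y + t)) (sumsq-↭ p))
  (solve 3 (λ a b c → a :+ (b :+ c) := b :+ (a :+ c)) refl (x * x) (y * y) _)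
sumsq-↭ (↭.trans p q)                   = trans (sumsq-↭ p) (sumsq-↭ q)

sq≤sq : ∀ {p q} → 0ℚ ≤ p → p ≤ q → p * p ≤ q * q
sq≤sq {p} {q} 0≤p p≤q =
  -- Here and below, an inequality is proved by exhibiting its slack as a nonnegative combination of
  -- known differences; the ring solver checks that the slack fills the gap.
  p≤p+r (*-nonNeg (p≤q⇒0≤q-p p≤q) (+-nonNeg 0≤p (≤-trans 0≤p p≤q)))
    (solve 2 (λ p q → p :* p :+ (q :- p) :* (p :+ q) := q :* q) refl p q)

sq-nonNeg : ∀ p → 0ℚ ≤ p * p
sq-nonNeg p with ≤-total 0ℚ p
... | inj₁ 0≤p = *-nonNeg 0≤p 0≤p
... | inj₂ p≤0 = subst (0ℚ ≤_) (solve 1 (λ p → (con 0ℚ :- p) :* (con 0ℚ :- p) := p :* p) refl p)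
                   (*-nonNeg (p≤q⇒0≤q-p p≤0) (p≤q⇒0≤q-p p≤0))

sumsq-nonNeg : ∀ xs → 0ℚ ≤ sumsq xs
sumsq-nonNeg []       = ≤-refl
sumsq-nonNeg (x ∷ xs) = +-nonNeg (sq-nonNeg x) (sumsq-nonNeg xs)

q*sum≤sumsq : ∀ {q xs} → 0ℚ ≤ q → All (q ≤_) xs → q * sum xs ≤ sumsq xs
q*sum≤sumsq {q} 0≤q [] = ≤-reflexive (*-zeroʳ q)
q*sum≤sumsq {q} {x ∷ xs} 0≤q (q≤x ∷ q≤xs) =
  p≤p+r (+-nonNeg (*-nonNeg (≤-trans 0≤q q≤x) (p≤q⇒0≤q-p q≤x)) (p≤q⇒0≤q-p (q*sum≤sumsq 0≤q q≤xs)))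
    (solve 4 (λ q x s t → q :* (x :+ s) :+ (x :* (x :- q) :+ (t :- q :* s)) := x :* x :+ t)
       refl q x (sum xs) (sumsq xs))

heights : List (List⁺ ℚ) → ℚ
heights = sum ∘ map head

Dominates : List ℚ → List ℚ → Set
Dominates F = All (λ q → All (q ≤_) F)

dominates-∷ʳ : ∀ {q F qs} → All (_≤ q) qs → Dominates F qs → Dominates (F ∷ʳ q) qs
dominates-∷ʳ []         []         = []
dominates-∷ʳ (r≤q ∷ ≤q) (r≤F ∷ ≤F) = ∷ʳ⁺ r≤F r≤q ∷ dominates-∷ʳ ≤q ≤F

-- The squares of a level after its first, together with the first square q of
-- the next level, have total width more than 1 - h₀ and sides at least q:
-- their area pays for the height q of the next level at the rate 1 - h₀.
heights-bound : ∀ {h₀ h} F qs → h ≤ h₀ → All (_≤ h₀) qs → All (0ℚ ≤_) qs →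
                Dominates F qs → AllPairs _≥_ qs →
                (1ℚ - h₀) * (heights (nextFit (h ∷ F) qs) - h) ≤ sumsq F + sumsq qs
heights-bound {h₀} {h} F [] h≤h₀ [] [] [] [] =
  p≤p+r (sumsq-nonNeg F)
    (solve 3 (λ h₀ h s → (con 1ℚ :- h₀) :* (h :+ con 0ℚ :- h) :+ s := s :+ con 0ℚ) refl h₀ h (sumsq F))
heights-bound {h₀} {h} F (q ∷ qs) h≤h₀ (q≤h₀ ∷ ≤h₀) (0≤q ∷ 0≤) (q≤F ∷ ≤F) (≤q ∷ ↘)
  with (h + sum F) + q ≤? 1ℚ
... | yes _ = subst ((1ℚ - h₀) * (heights (nextFit (h ∷ (F ∷ʳ q)) qs) - h) ≤_) (sumsq-∷ʳ F qs)
        (heights-bound (F ∷ʳ q) qs h≤h₀ ≤h₀ 0≤ (dominates-∷ʳ ≤q ≤F) ↘)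
... | no ≰1 = p≤p+r
        (+-nonNeg (+-nonNeg (p≤q⇒0≤q-p (q*sum≤sumsq 0≤q q≤F)) (p≤q⇒0≤q-p rest))
           (+-nonNeg (*-nonNeg 0≤q (p≤q⇒0≤q-p (<⇒≤ (≰⇒> ≰1)))) (*-nonNeg 0≤q (p≤q⇒0≤q-p h≤h₀))))
        (solve 7 (λ h₀ h q H s t u →
             (con 1ℚ :- h₀) :* (h :+ H :- h)
               :+ ((t :- q :* s) :+ ((con 0ℚ :+ u) :- (con 1ℚ :- h₀) :* (H :- q))
                   :+ (q :* (((h :+ s) :+ q) :- con 1ℚ) :+ q :* (h₀ :- h)))
             := t :+ (q :* q :+ u)) refl
           h₀ h q (heights (nextFit (q ∷ []) qs)) (sum F) (sumsq F) (sumsq qs))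
  where
  -- The later levels restart from `q ≤ h₀` at the unchanged rate `1 - h₀`, which is why the rate is
  -- not tied to the current height `h`.
  rest : (1ℚ - h₀) * (heights (nextFit (q ∷ []) qs) - q) ≤ 0ℚ + sumsq qs
  rest = heights-bound [] qs q≤h₀ ≤h₀ 0≤ (All.universal (λ _ → []) qs) ↘

module _ (P : ℚ → Set) where

  -- The moment when the first level closes: `others` are its squares after the first, and `next`
  -- opens the second level. `area` leaves out the first square of the bin, which is added later,
  -- and charges the levels from the third on at the rate `1 - next`. `P` carries facts on single
  -- squares to the case analysis.
  record FirstBreak (h : ℚ) (H A : ℚ) : Set where
    field
      {next}    : ℚ
      {others}  : List ℚ
      next-P    : P next
      others-P  : All P others
      dominates : All (next ≤_) others
      overflow  : 1ℚ < (h + sum others) + next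
      area      : sumsq others + next * next + (1ℚ - next) * (H - h - next) ≤ A

  -- The level is filled as in `nextFit` until it overflows; from `next` on, `heights-bound` with
  -- `h₀` equal to `next` gives the term for the remaining levels.
  first-break : ∀ {h} F qs → All P F → All P qs → All (0ℚ ≤_) qs →
                Dominates F qs → AllPairs _≥_ qs →
                heights (nextFit (h ∷ F) qs) ≡ h ⊎
                FirstBreak h (heights (nextFit (h ∷ F) qs)) (sumsq F + sumsq qs)
  first-break {h} F [] PF [] [] [] [] = inj₁ (+-identityʳ h)
  first-break {h} F (q ∷ qs) PF (Pq ∷ Pqs) (0≤q ∷ 0≤) (q≤F ∷ ≤F) (≤q ∷ ↘)
    with (h + sum F) + q ≤? 1ℚ
  ... | yes _ = subst (λ A → heights (nextFit (h ∷ (F ∷ʳ q)) qs) ≡ h ⊎ FirstBreak h (heights (nextFit (h ∷ (F ∷ʳ q)) qs)) A) (sumsq-∷ʳ F qs)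
        (first-break (F ∷ʳ q) qs (∷ʳ⁺ PF Pq) Pqs 0≤ (dominates-∷ʳ ≤q ≤F) ↘)
  ... | no ≰1 = inj₂ record
        { next-P = Pq ; others-P = PF ; dominates = q≤F ; overflow = ≰⇒> ≰1
        ; area = p≤p+r (p≤q⇒0≤q-p (heights-bound [] qs ≤-refl ≤q 0≤ (All.universal (λ _ → []) qs) ↘))
            (solve 5 (λ h q H t u → t :+ q :* q :+ (con 1ℚ :- q) :* (h :+ H :- h :- q)
                 :+ ((con 0ℚ :+ u) :- (con 1ℚ :- q) :* (H :- q)) := t :+ (q :* q :+ u)) refl
               h q (heights (nextFit (q ∷ []) qs)) (sumsq F) (sumsq qs)) }

-- Unit fractions up to 1/2 and the constant 7/12.

unitFraction-positive : ∀ {q} → UnitFraction q → 0ℚ < q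
unitFraction-positive (k , refl) = positive⁻¹ (+ 1 / suc k) {{normalize-pos 1 (suc k)}}

unitFraction-antimono : ∀ {j k} → j ℕ.≤ k → + 1 / suc k ≤ + 1 / suc j
unitFraction-antimono {j} {k} j≤k = toℚᵘ-cancel-≤ (begin
  toℚᵘ (+ 1 / suc k)     ≃⟨ toℚᵘ-fromℚᵘ (ℚᵘ.mkℚᵘ (+ 1) k) ⟩
  ℚᵘ.mkℚᵘ (+ 1) k         ≤⟨ ℚᵘ.*≤* (ℤ.*-monoˡ-≤-nonNeg (+ 1) (ℤ.+≤+ (s≤s j≤k))) ⟩
  ℚᵘ.mkℚᵘ (+ 1) j         ≃⟨ toℚᵘ-fromℚᵘ (ℚᵘ.mkℚᵘ (+ 1) j) ⟨
  toℚᵘ (+ 1 / suc j)     ∎)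
  where open ℚᵘ.≤-Reasoning

-- Sides of at most 1/5 need no finer distinction: even after a first square of side 1/2 the general
-- estimate then gives 1 - 1/4 - 4/25 = 59/100, more than 7/12.
data AtMostHalf : ℚ → Set where
  half    : AtMostHalf (+ 1 / 2)
  third   : AtMostHalf (+ 1 / 3)
  quarter : AtMostHalf (+ 1 / 4)
  rest    : ∀ {q} → q ≤ + 1 / 5 → AtMostHalf q

atMostHalf : ∀ {q} → UnitFraction q → q ≤ ½ → AtMostHalf q
atMostHalf (0 , refl) 1≤½ = contradiction 1≤½ (from-no (1ℚ ≤? ½))
atMostHalf (1 , refl) _ = half
atMostHalf (2 , refl) _ = third
atMostHalf (3 , refl) _ = quarter
atMostHalf (suc (suc (suc (suc k))) , refl) _ = rest (unitFraction-antimono {4} {suc (suc (suc (suc k)))} (s≤s (s≤s (s≤s (s≤s z≤n)))))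

-- The difference of the two sides is `(c - x) * (1ℚ - c - x)`, with both factors nonnegative.
x-x²-mono : ∀ {x c} → x ≤ c → c ≤ ½ → x * (1ℚ - x) ≤ c * (1ℚ - c)
x-x²-mono {x} {c} x≤c c≤½ =
  p≤p+r (*-nonNeg (p≤q⇒0≤q-p x≤c) (+-nonNeg (p≤q⇒0≤q-p c≤½) (p≤q⇒0≤q-p (≤-trans x≤c c≤½))))
    (solve 2 (λ x c → x :* (con 1ℚ :- x) :+ (c :- x) :* ((con ½ :- c) :+ (con ½ :- x))
       := c :* (con 1ℚ :- c)) refl x c)

-- A lower bound for the area when the first two levels start with h and q, the
-- first one is h ∷ G, and the later levels, of total height more than
-- 1 - h - q, contribute at least 1 - q per unit height.
lowerArea : ℚ → ℚ → List ℚ → ℚ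
lowerArea h q G = h * h + (sumsq G + q * q + (1ℚ - q) * (1ℚ - h - q))

-- The overflow makes `sumsq G` at least `q * (1ℚ - h - q)`. This completes the last term of
-- `lowerArea` to `1ℚ - h - q`, and the total becomes `1ℚ - h * (1ℚ - h) - q * (1ℚ - q)`, which only
-- decreases when `h` and `q` are raised to `c` and `d`, both at most 1/2.
lowerArea≥ : ∀ {h q G c d} → h ≤ c → c ≤ ½ → q ≤ d → d ≤ ½ → 0ℚ ≤ q →
             All (q ≤_) G → 1ℚ < (h + sum G) + q →
             1ℚ - (c * (1ℚ - c) + d * (1ℚ - d)) ≤ lowerArea h q G
lowerArea≥ {h} {q} {G} {c} {d} h≤c c≤½ q≤d d≤½ 0≤q q≤G 1< =
  p≤p+r (+-nonNeg (+-nonNeg (p≤q⇒0≤q-p (x-x²-mono h≤c c≤½)) (p≤q⇒0≤q-p (x-x²-mono q≤d d≤½)))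
           (+-nonNeg (p≤q⇒0≤q-p (q*sum≤sumsq 0≤q q≤G)) (*-nonNeg 0≤q (p≤q⇒0≤q-p (<⇒≤ 1<)))))
    (solve 6 (λ h q s t c d →
        (con 1ℚ :- (c :+ d))
        :+ (((c :- h :* (con 1ℚ :- h)) :+ (d :- q :* (con 1ℚ :- q)))
            :+ ((t :- q :* s) :+ q :* (((h :+ s) :+ q) :- con 1ℚ)))
        := h :* h :+ (t :+ q :* q :+ (con 1ℚ :- q) :* (con 1ℚ :- h :- q))) refl
      h q (sum G) (sumsq G) (c * (1ℚ - c)) (d * (1ℚ - d)))

lowerArea-mono : ∀ h q G {t} → t ≤ sumsq G →
                 h * h + (t + q * q + (1ℚ - q) * (1ℚ - h - q)) ≤ lowerArea h q G
lowerArea-mono h q G t≤ =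
  +-monoʳ-≤ (h * h) (+-monoˡ-≤ ((1ℚ - q) * (1ℚ - h - q)) (+-monoˡ-≤ (q * q) t≤))

sumsq≥₁ : ∀ {c a} as → 0ℚ ≤ c → c ≤ a → c * c ≤ sumsq (a ∷ as)
sumsq≥₁ {c} {a} as 0≤c c≤a = begin
  c * c              ≡⟨ +-identityʳ (c * c) ⟨
  c * c + 0ℚ         ≤⟨ +-mono-≤ (sq≤sq 0≤c c≤a) (sumsq-nonNeg as) ⟩
  sumsq (a ∷ as)     ∎
  where open ≤-Reasoning

sumsq≥₂ : ∀ {c a b} as → 0ℚ ≤ c → c ≤ a → c ≤ b → c * c + c * c ≤ sumsq (a ∷ b ∷ as)
sumsq≥₂ as 0≤c c≤a c≤b = +-mono-≤ (sq≤sq 0≤c c≤a) (sumsq≥₁ as 0≤c c≤b)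

no-overflow : ∀ h q {a c} → a ≤ c → (h + (c + 0ℚ)) + q ≤ 1ℚ → ¬ 1ℚ < (h + (a + 0ℚ)) + q
no-overflow h q a≤c ≤1 1< = <-irrefl refl (<-≤-trans 1<
  (≤-trans (+-monoˡ-≤ q (+-monoʳ-≤ h (+-monoˡ-≤ 0ℚ a≤c))) ≤1))

-- `lowerArea≥` suffices unless the first two heights are 1/2 followed by 1/2, 1/3 or 1/4, or 1/3
-- twice. There the overflow forces further squares into the first level, and their areas are
-- counted one by one; contents that would stay within width 1 are refuted.
lowerArea-7/12 : ∀ {h q G} → AtMostHalf h → AtMostHalf q → q ≤ h → 0ℚ ≤ q →
                 All (λ a → AtMostHalf a × a ≤ h) G → All (q ≤_) G →
                 1ℚ < (h + sum G) + q → + 7 / 12 ≤ lowerArea h q G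
lowerArea-7/12 (rest h≤) _ q≤h 0≤q _ q≤G 1< =
  ≤-trans (≤-dec (+ 7 / 12) _)
    (lowerArea≥ h≤ (≤-dec (+ 1 / 5) ½) (≤-trans q≤h h≤) (≤-dec (+ 1 / 5) ½) 0≤q q≤G 1<)
lowerArea-7/12 quarter _ q≤h 0≤q _ q≤G 1< =
  ≤-trans (≤-dec (+ 7 / 12) _)
    (lowerArea≥ {c = + 1 / 4} ≤-refl (≤-dec (+ 1 / 4) ½) q≤h (≤-dec (+ 1 / 4) ½) 0≤q q≤G 1<)
lowerArea-7/12 third half q≤h _ _ _ _ = contradiction q≤h (from-no (½ ≤? + 1 / 3))
lowerArea-7/12 third third q≤h 0≤q [] [] 1< = contradiction 1< (from-no (1ℚ <? (+ 1 / 3 + 0ℚ) + + 1 / 3))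
lowerArea-7/12 third third q≤h 0≤q ((_ , a≤h) ∷ []) _ 1< =
  contradiction 1< (no-overflow (+ 1 / 3) (+ 1 / 3) a≤h (≤-dec ((+ 1 / 3 + (+ 1 / 3 + 0ℚ)) + + 1 / 3) 1ℚ))
lowerArea-7/12 {G = G} third third q≤h 0≤q (_∷_ {xs = _ ∷ as} _ (_ ∷ _)) (q≤a ∷ q≤b ∷ _) 1< =
  ≤-trans (≤-dec (+ 7 / 12) _) (lowerArea-mono (+ 1 / 3) (+ 1 / 3) G (sumsq≥₂ as 0≤q q≤a q≤b))
lowerArea-7/12 third quarter q≤h 0≤q _ q≤G 1< =
  ≤-trans (≤-dec (+ 7 / 12) _)
    (lowerArea≥ {c = + 1 / 3} {d = + 1 / 4} ≤-refl (≤-dec (+ 1 / 3) ½) ≤-refl (≤-dec (+ 1 / 4) ½) 0≤q q≤G 1<)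
lowerArea-7/12 third (rest q≤) q≤h 0≤q _ q≤G 1< =
  ≤-trans (≤-dec (+ 7 / 12) _)
    (lowerArea≥ {c = + 1 / 3} ≤-refl (≤-dec (+ 1 / 3) ½) q≤ (≤-dec (+ 1 / 5) ½) 0≤q q≤G 1<)
lowerArea-7/12 half half q≤h 0≤q [] [] 1< = contradiction 1< (from-no (1ℚ <? (½ + 0ℚ) + ½))
lowerArea-7/12 {G = G} half half q≤h 0≤q (_∷_ {xs = as} _ _) (q≤a ∷ _) 1< =
  ≤-trans (≤-dec (+ 7 / 12) _) (lowerArea-mono ½ ½ G (sumsq≥₁ as 0≤q q≤a))
lowerArea-7/12 half third q≤h 0≤q [] [] 1< = contradiction 1< (from-no (1ℚ <? (½ + 0ℚ) + + 1 / 3))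
-- The critical case: 1/4 + 1/9 + 1/9 + (2/3)(1/6) is exactly 7/12.
lowerArea-7/12 {G = G} half third q≤h 0≤q (_∷_ {xs = as} _ _) (q≤a ∷ _) 1< =
  ≤-trans (≤-dec (+ 7 / 12) _) (lowerArea-mono ½ (+ 1 / 3) G (sumsq≥₁ as 0≤q q≤a))
lowerArea-7/12 half quarter q≤h 0≤q [] [] 1< = contradiction 1< (from-no (1ℚ <? (½ + 0ℚ) + + 1 / 4))
lowerArea-7/12 {G = G} half quarter q≤h 0≤q ((half , _) ∷ []) _ 1< = ≤-dec (+ 7 / 12) (lowerArea ½ (+ 1 / 4) G)
lowerArea-7/12 {G = G} half quarter q≤h 0≤q ((third , _) ∷ []) _ 1< = ≤-dec (+ 7 / 12) (lowerArea ½ (+ 1 / 4) G)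
lowerArea-7/12 half quarter q≤h 0≤q ((quarter , _) ∷ []) _ 1< = contradiction 1< (from-no (1ℚ <? (½ + (+ 1 / 4 + 0ℚ)) + + 1 / 4))
lowerArea-7/12 half quarter q≤h 0≤q ((rest a≤ , _) ∷ []) _ 1< =
  contradiction 1< (no-overflow ½ (+ 1 / 4) a≤ (≤-dec ((½ + (+ 1 / 5 + 0ℚ)) + + 1 / 4) 1ℚ))
lowerArea-7/12 {G = G} half quarter q≤h 0≤q (_∷_ {xs = _ ∷ as} _ (_ ∷ _)) (q≤a ∷ q≤b ∷ _) 1< =
  ≤-trans (≤-dec (+ 7 / 12) _) (lowerArea-mono ½ (+ 1 / 4) G (sumsq≥₂ as 0≤q q≤a q≤b))
lowerArea-7/12 half (rest q≤) q≤h 0≤q _ q≤G 1< =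
  ≤-trans (≤-dec (+ 7 / 12) _)
    (lowerArea≥ {c = ½} ≤-refl ≤-refl q≤ (≤-dec (+ 1 / 5) ½) 0≤q q≤G 1<)

area : List Item → ℚ
area = sumsq ∘ map side

AtMostHalfItem : Item → Set
AtMostHalfItem s = UnitFraction (side s) × side s ≤ ½

-- A single level has height at most 1/2, so a failure means that some level closes. The total
-- height exceeds 1 and may be replaced by 1 in the `area` of the break; adding the square of the
-- first side gives `lowerArea`.
heights-area : ∀ {xs} → All UnitFraction xs → All (_≤ ½) xs → AllPairs _≥_ xs →
               ¬ heights (levelsOfSorted xs) ≤ 1ℚ → + 7 / 12 ≤ sumsq xs
heights-area {[]} _ _ _ ≰1 = contradiction (≤-dec 0ℚ 1ℚ) ≰1
heights-area {h ∷ qs} (uh ∷ uqs) (h≤½ ∷ qs≤½) (qs≤h ∷ ↘) ≰1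
  with first-break (λ q → UnitFraction q × q ≤ h) {h} [] qs [] (All.zip (uqs , qs≤h))
         (All.map (<⇒≤ ∘ unitFraction-positive) uqs) (All.universal (λ _ → []) qs) ↘
... | inj₁ ≡h = contradiction (≤-trans (≤-reflexive ≡h) (≤-trans h≤½ (≤-dec ½ 1ℚ))) ≰1
... | inj₂ b = ≤-trans
  (lowerArea-7/12 (atMostHalf uh h≤½) (atMostHalf uq (≤-trans q≤h h≤½)) q≤h 0≤q
     (All.map (λ (u , ≤h) → atMostHalf u (≤-trans ≤h h≤½) , ≤h) b.others-P) b.dominates b.overflow)
  (p≤p+r (+-nonNeg (p≤q⇒0≤q-p b.area)
            (*-nonNeg (p≤q⇒0≤q-p (≤-trans q≤h (≤-trans h≤½ (≤-dec ½ 1ℚ)))) (p≤q⇒0≤q-p (<⇒≤ (≰⇒> ≰1)))))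
     (solve 5 (λ h q H g s →
         h :* h :+ (g :+ q :* q :+ (con 1ℚ :- q) :* (con 1ℚ :- h :- q))
         :+ (((con 0ℚ :+ s) :- (g :+ q :* q :+ (con 1ℚ :- q) :* (H :- h :- q)))
             :+ (con 1ℚ :- q) :* (H :- con 1ℚ))
         := h :* h :+ s) refl h b.next (heights (nextFit (h ∷ []) qs)) (sumsq b.others) (sumsq qs)))
  where
  module b = FirstBreak b
  uq = proj₁ b.next-P
  q≤h = proj₂ b.next-P
  0≤q = <⇒≤ (unitFraction-positive uq)

module ≥-Sort = SortingAlgorithm (insertionSort ≥-decTotalOrder)

NFDH-area : ∀ {B} → All AtMostHalfItem B → ¬ NFDH B → + 7 / 12 ≤ area B
NFDH-area {B} half-B fails =
  subst (+ 7 / 12 ≤_) (sumsq-↭ sorted-↭)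
    (heights-area (resp (All.map proj₁ half-B)) (resp (All.map proj₂ half-B))
      (Linked⇒AllPairs (λ y≤x z≤y → ≤-trans z≤y y≤x) (≥-Sort.sort-↗ (map side B))) fails)
  where
  sorted-↭ : sort ≥-decTotalOrder (map side B) ↭ map side B
  sorted-↭ = ≥-Sort.sort-↭ (map side B)
  resp : ∀ {P : ℚ → Set} → All (P ∘ side) B → All P (sort ≥-decTotalOrder (map side B))
  resp ps = All-resp-↭ (↭-sym sorted-↭) (All.map⁺ ps)

-- NFDH on at most four squares.

½+½ : ∀ {p q} → p ≤ ½ → q ≤ ½ → p + (q + 0ℚ) ≤ 1ℚ
½+½ p≤½ q≤½ = +-mono-≤ p≤½ (+-monoˡ-≤ 0ℚ q≤½)

½+0 : ∀ {p} → p ≤ ½ → p + 0ℚ ≤ 1ℚ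
½+0 p≤½ = ≤-trans (+-monoˡ-≤ 0ℚ p≤½) (≤-dec (½ + 0ℚ) 1ℚ)

-- Two squares of side at most 1/2 always share a level. So the squares still to come open at most
-- one further level, and two levels have total height at most 1/2 + 1/2.
heights-two : ∀ {a b} F qs → All (_≤ ½) (a ∷ b ∷ qs) → length qs ℕ.≤ 2 →
              heights (nextFit (a ∷ b ∷ F) qs) ≤ 1ℚ
heights-two F [] (a≤ ∷ _) _ = ½+0 a≤
heights-two {a} {b} F (c ∷ []) (a≤ ∷ _ ∷ c≤ ∷ []) _
  with a + (b + sum F) + c ≤? 1ℚ
... | yes _ = ½+0 a≤
... | no  _ = ½+½ a≤ c≤
heights-two {a} {b} F (c ∷ d ∷ []) (a≤ ∷ _ ∷ c≤ ∷ d≤ ∷ []) _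
  with a + (b + sum F) + c ≤? 1ℚ
... | no _ with (c + 0ℚ) + d ≤? 1ℚ
...   | yes _ = ½+½ a≤ c≤
...   | no ≰1 = contradiction (subst (_≤ 1ℚ) (cong (_+ d) (sym (+-identityʳ c))) (+-mono-≤ c≤ d≤)) ≰1
heights-two {a} {b} F (c ∷ d ∷ []) (a≤ ∷ _ ∷ c≤ ∷ d≤ ∷ []) _ | yes _
  with a + sum (b ∷ F ∷ʳ c) + d ≤? 1ℚ
... | yes _ = ½+0 a≤
... | no  _ = ½+½ a≤ d≤
heights-two F (_ ∷ _ ∷ _ ∷ _) _ (s≤s (s≤s ()))

heights-four : ∀ {xs} → All (_≤ ½) xs → length xs ℕ.≤ 4 → heights (levelsOfSorted xs) ≤ 1ℚ
heights-four [] _ = ≤-dec 0ℚ 1ℚ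
heights-four (a≤ ∷ []) _ = ½+0 a≤
heights-four {a ∷ b ∷ qs} (a≤ ∷ b≤ ∷ ≤½) (s≤s (s≤s len)) with (a + 0ℚ) + b ≤? 1ℚ
... | yes _ = heights-two [] qs (a≤ ∷ b≤ ∷ ≤½) len
... | no ≰1 = contradiction (subst (_≤ 1ℚ) (cong (_+ b) (sym (+-identityʳ a))) (+-mono-≤ a≤ b≤)) ≰1

NFDH-four : ∀ {B} → All (λ s → side s ≤ ½) B → length B ℕ.≤ 4 → NFDH B
NFDH-four {B} ≤½ len = heights-four {sort ≥-decTotalOrder (map side B)} (All-resp-↭ (↭-sym sorted-↭) (All.map⁺ ≤½))
  (subst (ℕ._≤ 4) (sym (trans (↭-length sorted-↭) (length-map side B))) len)
  where
  sorted-↭ = ≥-Sort.sort-↭ (map side B)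

rejected-small : ∀ {s B} → Small s → UnitFraction (side s) → All AtMostHalfItem B →
                 ¬ NFDH (s ∷ B) → + 17 / 36 ≤ area B
rejected-small {s} {B} small u half-B fails =
  p≤p+r (+-nonNeg (p≤q⇒0≤q-p (NFDH-area {s ∷ B} ((u , ≤-trans small (≤-dec (+ 1 / 3) ½)) ∷ half-B) fails))
           (p≤q⇒0≤q-p (sq≤sq (<⇒≤ (unitFraction-positive u)) small)))
    (solve 2 (λ s A → con (+ 17 / 36) :+ (((s :* s :+ A) :- con (+ 7 / 12))
        :+ (con (+ 1 / 9) :- s :* s)) := A) refl (side s) (area B))

rejected-medium : ∀ {s B} → AtMostHalfItem s → All AtMostHalfItem B →
                  ¬ NFDH (s ∷ B) → + 1 / 3 ≤ area B
rejected-medium {s} {B} (u , ≤½) half-B fails =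
  p≤p+r (+-nonNeg (p≤q⇒0≤q-p (NFDH-area {s ∷ B} ((u , ≤½) ∷ half-B) fails))
           (p≤q⇒0≤q-p (sq≤sq (<⇒≤ (unitFraction-positive u)) ≤½)))
    (solve 2 (λ s A → con (+ 1 / 3) :+ (((s :* s :+ A) :- con (+ 7 / 12))
        :+ (con (+ 1 / 4) :- s :* s)) := A) refl (side s) (area B))

four-halves : ∀ {B} → All (λ t → side t ≡ ½) B → 4 ℕ.≤ length B → 1ℚ ≤ area B
four-halves {_ ∷ _ ∷ _ ∷ _ ∷ B} (a ∷ b ∷ c ∷ d ∷ _) _ rewrite a | b | c | d =
  +-monoʳ-≤ ¼ (+-monoʳ-≤ ¼ (+-monoʳ-≤ ¼ (+-monoʳ-≤ ¼ (sumsq-nonNeg (map side B)))))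
  where ¼ = + 1 / 4
four-halves {_ ∷ []} _ (s≤s ())
four-halves {_ ∷ _ ∷ []} _ (s≤s (s≤s ()))
four-halves {_ ∷ _ ∷ _ ∷ []} _ (s≤s (s≤s (s≤s ())))

-- With three squares or fewer in `B`, adding `s` makes at most four, which `NFDH-four` packs. So a
-- failure leaves at least four squares of area 1/4 in `B`.
rejected-full : ∀ {s B} → side s ≤ ½ → All (λ t → side t ≡ ½) B → ¬ NFDH (s ∷ B) → 1ℚ ≤ area B
rejected-full {s} {B} s≤½ halves fails with length B ℕ.≤? 3
... | yes ≤3 = contradiction
        (NFDH-four {s ∷ B} (s≤½ ∷ All.map (λ eq → ≤-reflexive eq) halves) (s≤s ≤3)) fails
... | no ≰3 = four-halves halves (ℕ.≰⇒> ≰3)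

-- The area bound for packings

∑-mono : ∀ {n} {f g : Fin n → ℕ} → (∀ i → f i ℕ.≤ g i) → ∑ f ℕ.≤ ∑ g
∑-mono {zero}  f≤g = z≤n
∑-mono {suc n} f≤g = ℕ.+-mono-≤ (f≤g zero) (∑-mono (f≤g ∘ suc))

∑-const : ∀ n c → ∑ {n} (λ _ → c) ≡ n ℕ.* c
∑-const zero    c = refl
∑-const (suc n) c = cong (c ℕ.+_) (∑-const n c)

∑≤1 : ∀ {n} (c : Fin n → ℕ) → (∀ k → c k ℕ.≤ 1) →
      (∀ k l → k ≢ l → c k ≡ 0 ⊎ c l ≡ 0) → ∑ c ℕ.≤ 1
∑≤1 {zero}  c c≤1 excl = z≤n
∑≤1 {suc n} c c≤1 excl with c zero in eq
... | zero = ∑≤1 (c ∘ suc) (c≤1 ∘ suc) (λ k l k≢l → excl (suc k) (suc l) (k≢l ∘ λ { refl → refl }))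
... | suc m = ℕ.≤-trans (ℕ.≤-reflexive (trans (cong (suc m ℕ.+_) rest≡0) (ℕ.+-identityʳ (suc m))))
                (subst (ℕ._≤ 1) eq (c≤1 zero))
  where
  zeros : ∀ k → c (suc k) ≡ 0
  zeros k with excl zero (suc k) (λ ())
  ... | inj₁ c≡0 = contradiction (trans (sym eq) c≡0) (λ ())
  ... | inj₂ c≡0 = c≡0
  rest≡0 : ∑ (c ∘ suc) ≡ 0
  rest≡0 = trans (∑-cong zeros) (trans (∑-const n 0) (ℕ.*-zeroʳ n))

-- The indicator of x ≤ i < x + a.
indicator : (x a i : ℕ) → ℕ
indicator zero    zero    i       = 0
indicator zero    (suc a) zero    = 1
indicator zero    (suc a) (suc i) = indicator zero a i
indicator (suc x) a       zero    = 0
indicator (suc x) a       (suc i) = indicator x a i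

∑-indicator : ∀ {N} x a → x ℕ.+ a ℕ.≤ N → ∑ {N} (indicator x a ∘ toℕ) ≡ a
∑-indicator {N}     zero    zero    _         = trans (∑-const N 0) (ℕ.*-zeroʳ N)
∑-indicator {suc N} zero    (suc a) (s≤s a≤N) = cong suc (∑-indicator zero a a≤N)
∑-indicator {suc N} (suc x) a       (s≤s ≤N)  = ∑-indicator x a ≤N

indicator-cases : ∀ x a i → indicator x a i ≡ 0 ⊎ (indicator x a i ≡ 1 × x ℕ.≤ i × i ℕ.< x ℕ.+ a)
indicator-cases zero    zero    i       = inj₁ refl
indicator-cases zero    (suc a) zero    = inj₂ (refl , z≤n , s≤s z≤n)
indicator-cases zero    (suc a) (suc i) with indicator-cases zero a i
... | inj₁ ≡0            = inj₁ ≡0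
... | inj₂ (≡1 , _ , i<) = inj₂ (≡1 , z≤n , s≤s i<)
indicator-cases (suc x) a       zero    = inj₁ refl
indicator-cases (suc x) a       (suc i) with indicator-cases x a i
... | inj₁ ≡0              = inj₁ ≡0
... | inj₂ (≡1 , x≤i , i<) = inj₂ (≡1 , s≤s x≤i , s≤s i<)

indicator≤1 : ∀ x a i → indicator x a i ℕ.≤ 1
indicator≤1 x a i with indicator-cases x a i
... | inj₁ ≡0       = subst (ℕ._≤ 1) (sym ≡0) z≤n
... | inj₂ (≡1 , _) = ℕ.≤-reflexive ≡1

-- Fubini: a weighted sum of lengths is bounded slice by slice.
∑-slices : ∀ {n} N {C} (x a w : Fin n → ℕ) → (∀ k → x k ℕ.+ a k ℕ.≤ N) →
           (∀ {i} → i ℕ.< N → ∑ (λ k → indicator (x k) (a k) i ℕ.* w k) ℕ.≤ C) →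
           ∑ (λ k → a k ℕ.* w k) ℕ.≤ N ℕ.* C
∑-slices {n} N {C} x a w ≤N slice≤C = begin
  ∑ (λ k → a k ℕ.* w k)
    ≡⟨ ∑-cong (λ k → cong (ℕ._* w k) (sym (∑-indicator (x k) (a k) (≤N k)))) ⟩
  ∑ (λ k → ∑ {N} (indicator (x k) (a k) ∘ toℕ) ℕ.* w k)
    ≡⟨ ∑-cong (λ k → *-distribʳ-sum {N} (w k) (indicator (x k) (a k) ∘ toℕ)) ⟩
  ∑ (λ k → ∑ {N} (λ i → indicator (x k) (a k) (toℕ i) ℕ.* w k))
    ≡⟨ ∑-comm {n} {N} (λ k i → indicator (x k) (a k) (toℕ i) ℕ.* w k) ⟩
  ∑ {N} (λ i → ∑ (λ k → indicator (x k) (a k) (toℕ i) ℕ.* w k))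
    ≤⟨ ∑-mono {N} (λ i → slice≤C (toℕ<n i)) ⟩
  ∑ {N} (λ _ → C)
    ≡⟨ ∑-const N C ⟩
  N ℕ.* C ∎
  where open ℕ.≤-Reasoning

DisjointSquares : (x y a x′ y′ a′ : ℕ) → Set
DisjointSquares x y a x′ y′ a′ =
  x ℕ.+ a ℕ.≤ x′ ⊎ x′ ℕ.+ a′ ℕ.≤ x ⊎ y ℕ.+ a ℕ.≤ y′ ⊎ y′ ℕ.+ a′ ℕ.≤ y

-- Squares packed into K bins of side N are boxes in a K × N × N grid.
grid-area : ∀ {n} K N (z x y a : Fin n → ℕ) → (∀ k → z k ℕ.< K) →
            (∀ k → x k ℕ.+ a k ℕ.≤ N) → (∀ k → y k ℕ.+ a k ℕ.≤ N) →
            (∀ k l → k ≢ l → z k ≡ z l → DisjointSquares (x k) (y k) (a k) (x l) (y l) (a l)) →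
            ∑ (λ k → a k ℕ.* a k) ℕ.≤ K ℕ.* (N ℕ.* N)
grid-area K N z x y a z<K x≤N y≤N disjoint = begin
  ∑ (λ k → a k ℕ.* a k)
    ≡⟨ ∑-cong (λ k → ℕ.*-identityˡ (a k ℕ.* a k)) ⟨
  ∑ (λ k → 1 ℕ.* (a k ℕ.* a k))
    -- Three rounds of slicing: by bins, where every box has length 1, then by `x` in `slab` and by
    -- `y` in `column`, which leaves single cells.
    ≤⟨ ∑-slices K z (λ _ → 1) (λ k → a k ℕ.* a k) (λ k → subst (ℕ._≤ K) (ℕ.+-comm 1 (z k)) (z<K k)) (λ {b} _ → slab b) ⟩
  K ℕ.* (N ℕ.* N) ∎
  where
  open ℕ.≤-Reasoning
  -- `c b i j k` indicates whether square `k` covers the cell `(i , j)` of bin `b`.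
  c : ℕ → ℕ → ℕ → _ → ℕ
  c b i j k = indicator (y k) (a k) j ℕ.* (indicator (x k) (a k) i ℕ.* indicator (z k) 1 b)

  c≤1 : ∀ b i j k → c b i j k ℕ.≤ 1
  c≤1 b i j k = ℕ.*-mono-≤ (indicator≤1 (y k) (a k) j)
                  (ℕ.*-mono-≤ (indicator≤1 (x k) (a k) i) (indicator≤1 (z k) 1 b))

  zero₂ : ∀ p {q r} → q ≡ 0 → p ℕ.* (q ℕ.* r) ≡ 0
  zero₂ p refl = ℕ.*-zeroʳ p

  zero₃ : ∀ p q {r} → r ≡ 0 → p ℕ.* (q ℕ.* r) ≡ 0
  zero₃ p q refl = trans (cong (p ℕ.*_) (ℕ.*-zeroʳ q)) (ℕ.*-zeroʳ p)

  covers : ∀ b i j k → c b i j k ≡ 0 ⊎ (z k ≡ b × (x k ℕ.≤ i × i ℕ.< x k ℕ.+ a k) × (y k ℕ.≤ j × j ℕ.< y k ℕ.+ a k))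
  covers b i j k with indicator-cases (y k) (a k) j | indicator-cases (x k) (a k) i | indicator-cases (z k) 1 b
  ... | inj₁ ≡0 | _ | _ = inj₁ (cong (ℕ._* _) ≡0)
  ... | inj₂ _ | inj₁ ≡0 | _ = inj₁ (zero₂ (indicator (y k) (a k) j) ≡0)
  ... | inj₂ _ | inj₂ _ | inj₁ ≡0 = inj₁ (zero₃ (indicator (y k) (a k) j) (indicator (x k) (a k) i) ≡0)
  ... | inj₂ (_ , y∋) | inj₂ (_ , x∋) | inj₂ (_ , z≤b , b<) =
        inj₂ (ℕ.≤-antisym z≤b (ℕ.≤-pred (subst (b ℕ.<_) (ℕ.+-comm (z k) 1) b<)) , x∋ , y∋)

  cell : ∀ b i j → ∑ (c b i j) ℕ.≤ 1
  cell b i j = ∑≤1 (c b i j) (c≤1 b i j) excl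
    where
    excl : ∀ k l → k ≢ l → c b i j k ≡ 0 ⊎ c b i j l ≡ 0
    excl k l k≢l with covers b i j k | covers b i j l
    ... | inj₁ ≡0 | _ = inj₁ ≡0
    ... | inj₂ _ | inj₁ ≡0 = inj₂ ≡0
    -- Two squares over one cell overlap along both axes, against each of the four separations.
    ... | inj₂ (zk , (xk≤ , <xk) , (yk≤ , <yk)) | inj₂ (zl , (xl≤ , <xl) , (yl≤ , <yl))
      with disjoint k l k≢l (trans zk (sym zl))
    ... | inj₁ ≤x                = contradiction (ℕ.<-≤-trans <xk (ℕ.≤-trans ≤x xl≤)) (ℕ.<-irrefl refl)
    ... | inj₂ (inj₁ ≤x)         = contradiction (ℕ.<-≤-trans <xl (ℕ.≤-trans ≤x xk≤)) (ℕ.<-irrefl refl)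
    ... | inj₂ (inj₂ (inj₁ ≤y))  = contradiction (ℕ.<-≤-trans <yk (ℕ.≤-trans ≤y yl≤)) (ℕ.<-irrefl refl)
    ... | inj₂ (inj₂ (inj₂ ≤y))  = contradiction (ℕ.<-≤-trans <yl (ℕ.≤-trans ≤y yk≤)) (ℕ.<-irrefl refl)

  swap-factors : ∀ p q r → p ℕ.* (q ℕ.* r) ≡ q ℕ.* (r ℕ.* p)
  swap-factors p q r = trans (ℕ.*-comm p (q ℕ.* r)) (ℕ.*-assoc q r p)

  column : ∀ b i → ∑ (λ k → a k ℕ.* (indicator (x k) (a k) i ℕ.* indicator (z k) 1 b)) ℕ.≤ N
  column b i = subst (_ ℕ.≤_) (ℕ.*-identityʳ N)
    (∑-slices N y a (λ k → indicator (x k) (a k) i ℕ.* indicator (z k) 1 b) y≤N (λ {j} _ → cell b i j))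

  slab : ∀ b → ∑ (λ k → indicator (z k) 1 b ℕ.* (a k ℕ.* a k)) ℕ.≤ N ℕ.* N
  slab b = subst (ℕ._≤ N ℕ.* N)
    (∑-cong (λ k → sym (swap-factors (indicator (z k) 1 b) (a k) (a k))))
    (∑-slices N x a (λ k → a k ℕ.* indicator (z k) 1 b) x≤N
      (λ {i} _ → subst (ℕ._≤ N)
        (∑-cong (λ k → trans (swap-factors (a k) (indicator (x k) (a k) i) (indicator (z k) 1 b))
                         (cong (indicator (x k) (a k) i ℕ.*_) (ℕ.*-comm (indicator (z k) 1 b) (a k)))))
        (column b i)))

-- From rational packings to the integer grid.

record Scales (N : ℕ) (q : ℚ) : Set where
  constructor scales
  field
    multiple : ℕ
    scaled   : q * ι N ≡ ι multiple

open Scales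

scales-* : ∀ M {N q} → Scales N q → Scales (N ℕ.* M) q
scales-* M {N} {q} (scales n eq) = scales (n ℕ.* M) (trans (cong (q *_) (ι-* N M))
  (trans (sym (*-assoc q (ι N) (ι M))) (trans (cong (_* ι M) eq) (sym (ι-* n M)))))

*-scales : ∀ M {N q} → Scales N q → Scales (M ℕ.* N) q
*-scales M {N} {q} s = subst (λ L → Scales L q) (ℕ.*-comm N M) (scales-* M s)

denominator-scales : ∀ {q} → 0ℚ ≤ q → ∃[ d ] Scales (suc d) q
denominator-scales {mkℚ (+ p) d c} _ = d , scales p (trans
  (cong (mkℚ (+ p) d c *_) (ι-mkℚ (suc d)))
  (fromℚᵘ-cong {ℚᵘ.mkℚᵘ (+ p ℤ.* + suc d) _} {ℚᵘ.mkℚᵘ (+ p) 0}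
    (ℚᵘ.*≡* (trans (ℤ.*-identityʳ (+ p ℤ.* + suc d)) (cong (λ e → + p ℤ.* + e) (sym (ℕ.*-identityʳ (suc d))))))))
denominator-scales {mkℚ ℤ.-[1+ _ ] _ _} (*≤* ())

-- Counting cells needs integer coordinates, and a product of denominators makes all of them
-- integral. The form `suc d` keeps the scale nonzero, so that it can be cancelled at the end.
common-denominator : ∀ {n} (f : Fin n → ℚ) → (∀ k → 0ℚ ≤ f k) → ∃[ d ] (∀ k → Scales (suc d) (f k))
common-denominator {ℕ.zero}  f _   = 0 , λ ()
common-denominator {suc n} f 0≤f with denominator-scales (0≤f zero) | common-denominator (f ∘ suc) (0≤f ∘ suc)
... | d , s | e , ss = _ , λ { zero → scales-* (suc e) s ; (suc k) → *-scales (suc d) (ss k) }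

area-scaled : ∀ N P (a : Fin (length P) → ℕ) → (∀ k → side (lookup P k) * ι N ≡ ι (a k)) →
              area P * ι (N ℕ.* N) ≡ ι (∑ (λ k → a k ℕ.* a k))
area-scaled N []      a eq = *-zeroˡ (ι (N ℕ.* N))
area-scaled N (s ∷ P) a eq = trans (*-distribʳ-+ (ι (N ℕ.* N)) (side s * side s) (area P))
  (trans (cong₂ _+_ head-eq (area-scaled N P (a ∘ suc) (eq ∘ suc))) (sym (ι-+ (a zero ℕ.* a zero) _)))
  where
  head-eq : side s * side s * ι (N ℕ.* N) ≡ ι (a zero ℕ.* a zero)
  head-eq = trans (cong (side s * side s *_) (ι-* N N))
    (trans (solve 2 (λ s n → s :* s :* (n :* n) := (s :* n) :* (s :* n)) refl (side s) (ι N))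
      (trans (cong₂ _*_ (eq zero) (eq zero)) (sym (ι-* (a zero) (a zero)))))

module _ {P} (p : Packing P) where
  private module p = Packing p

  packing-area-scaled : ∀ N .{{_ : ℕ.NonZero (N ℕ.* N)}} → (∀ k → Scales N (p.x k)) → (∀ k → Scales N (p.y k)) →
                        (∀ k → Scales N (p.a k)) → area P ≤ ι p.activeBins
  packing-area-scaled N x-scales y-scales a-scales =
    *-cancelʳ-≤-pos (ι (N ℕ.* N)) {{normalize-pos (N ℕ.* N) 1}} (begin
      area P * ι (N ℕ.* N)           ≡⟨ area-scaled N P a′ (scaled ∘ a-scales) ⟩
      ι (∑ (λ k → a′ k ℕ.* a′ k))    ≤⟨ ι-mono-≤ (grid-area p.activeBins N z x′ y′ a′ (λ k → toℕ<n (index (bin∈ k))) x≤N y≤N disj) ⟩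
      ι (p.activeBins ℕ.* (N ℕ.* N)) ≡⟨ ι-* p.activeBins (N ℕ.* N) ⟩
      ι p.activeBins * ι (N ℕ.* N)   ∎)
    where
    open ≤-Reasoning
    x′ = multiple ∘ x-scales
    y′ = multiple ∘ y-scales
    a′ = multiple ∘ a-scales
    bin∈ : ∀ k → p.bin k ∈ deduplicate ℕ._≟_ (tabulate p.bin)
    bin∈ k = ∈-deduplicate⁺ ℕ._≟_ (∈-tabulate⁺ k)
    -- Bin numbers are arbitrary naturals; positions in the list of distinct numbers in use renumber
    -- them below `p.activeBins`, the number of slabs.
    z : Fin (length P) → ℕ
    z k = toℕ (index (bin∈ k))

    scale-≤ : ∀ {u v w} → (U : Scales N u) (V : Scales N v) (W : Scales N w) → u + v ≤ w →
              multiple U ℕ.+ multiple V ℕ.≤ multiple W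
    scale-≤ {u} {v} {w} (scales m um) (scales n vn) (scales l wl) le = ι-cancel-≤ (begin
      ι (m ℕ.+ n)         ≡⟨ ι-+ m n ⟩
      ι m + ι n           ≡⟨ cong₂ _+_ um vn ⟨
      u * ι N + v * ι N   ≡⟨ *-distribʳ-+ (ι N) u v ⟨
      (u + v) * ι N       ≤⟨ *-monoʳ-≤-nonNeg (ι N) {{normalize-nonNeg N 1}} le ⟩
      w * ι N             ≡⟨ wl ⟩
      ι l                 ∎)

    x≤N : ∀ k → x′ k ℕ.+ a′ k ℕ.≤ N
    x≤N k = scale-≤ (x-scales k) (a-scales k) (scales N (*-identityˡ (ι N))) (proj₂ (proj₁ (p.inside k)))
    y≤N : ∀ k → y′ k ℕ.+ a′ k ℕ.≤ N
    y≤N k = scale-≤ (y-scales k) (a-scales k) (scales N (*-identityˡ (ι N))) (proj₂ (proj₂ (p.inside k)))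

    disj : ∀ k l → k ≢ l → z k ≡ z l → DisjointSquares (x′ k) (y′ k) (a′ k) (x′ l) (y′ l) (a′ l)
    disj k l k≢l z≡ with p.disjoint k l k≢l (trans (lookup-index (bin∈ k))
        (trans (cong (lookup (deduplicate ℕ._≟_ (tabulate p.bin))) (toℕ-injective z≡)) (sym (lookup-index (bin∈ l)))))
    ... | inj₁ le               = inj₁ (scale-≤ (x-scales k) (a-scales k) (x-scales l) le)
    ... | inj₂ (inj₁ le)        = inj₂ (inj₁ (scale-≤ (x-scales l) (a-scales l) (x-scales k) le))
    ... | inj₂ (inj₂ (inj₁ le)) = inj₂ (inj₂ (inj₁ (scale-≤ (y-scales k) (a-scales k) (y-scales l) le)))
    ... | inj₂ (inj₂ (inj₂ le)) = inj₂ (inj₂ (inj₂ (scale-≤ (y-scales l) (a-scales l) (y-scales k) le)))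

  packing-area : All (λ s → 0ℚ ≤ side s) P → area P ≤ ι p.activeBins
  packing-area 0≤P
    with common-denominator p.x (proj₁ ∘ proj₁ ∘ p.inside)
       | common-denominator p.y (proj₁ ∘ proj₂ ∘ p.inside)
       | common-denominator p.a (λ k → All.lookup 0≤P (∈-lookup k))
  ... | d , xs | e , ys | f , as = packing-area-scaled (suc d ℕ.* suc e ℕ.* suc f)
        (λ k → scales-* (suc f) (scales-* (suc e) (xs k)))
        (λ k → scales-* (suc f) (*-scales (suc d) (ys k)))
        (λ k → *-scales (suc d ℕ.* suc e) (as k))

-- Runs of SMB

medium-is-half : ∀ {q} → UnitFraction q → + 1 / 3 < q → q ≤ ½ → q ≡ ½
medium-is-half u ⅓< ≤½ with atMostHalf u ≤½
... | half    = refl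
... | third   = contradiction refl (<⇒≢ ⅓<)
... | quarter = contradiction ⅓< (from-no (+ 1 / 3 <? + 1 / 4))
... | rest ≤⅕ = contradiction (<-≤-trans ⅓< ≤⅕) (from-no (+ 1 / 3 <? + 1 / 5))

big-is-unit : ∀ {q} → UnitFraction q → ½ < q → q ≡ 1ℚ
big-is-unit (0     , refl) _  = refl
big-is-unit (suc k , refl) ½< = contradiction (<-≤-trans ½< (unitFraction-antimono {1} {suc k} (s≤s z≤n))) (<-irrefl refl)

area-++ : ∀ A {B} → area (A ++ B) ≡ area A + area B
area-++ A {B} = trans (cong sumsq (map-++ side A B)) (sumsq-++ (map side A))

area-↭ : ∀ {A B} → A ↭ B → area A ≡ area B
area-↭ p = sumsq-↭ (map⁺ side p)

area-nonNeg : ∀ B → 0ℚ ≤ area B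
area-nonNeg B = sumsq-nonNeg (map side B)

count-by-area : ∀ {c Bs} → All (λ B → c ≤ area B) Bs → c * ι (length Bs) ≤ area (concat Bs)
count-by-area {c} [] = ≤-reflexive (*-zeroʳ c)
count-by-area {c} {B ∷ Bs} (c≤B ∷ c≤Bs) = begin
  c * ι (suc (length Bs))      ≡⟨ cong (c *_) (ι-suc (length Bs)) ⟩
  c * (1ℚ + ι (length Bs))     ≡⟨ solve 2 (λ c n → c :* (con 1ℚ :+ n) := c :+ c :* n) refl c (ι (length Bs)) ⟩
  c + c * ι (length Bs)        ≤⟨ +-mono-≤ c≤B (count-by-area c≤Bs) ⟩
  area B + area (concat Bs)    ≡⟨ area-++ B ⟨
  area (B ++ concat Bs)        ∎
  where open ≤-Reasoning

-- One square of side `c` already gives an active bin area `c * c`. No rejection is involved, so the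
-- estimate is available at every moment, however many squares have left. It serves ℳ with side 1/2
-- and ℬ with side 1.
nonempty-by-area : ∀ {c Bs} → All (All (λ s → side s ≡ c)) Bs → c * c * ι (nonempty Bs) ≤ area (concat Bs)
nonempty-by-area {c} [] = ≤-reflexive (*-zeroʳ (c * c))
nonempty-by-area {c} {[] ∷ Bs} ([] ∷ ps) = nonempty-by-area ps
nonempty-by-area {c} {(s ∷ B) ∷ Bs} ((refl ∷ _) ∷ ps) = begin
  c * c * ι (suc (nonempty Bs))         ≡⟨ cong (c * c *_) (ι-suc (nonempty Bs)) ⟩
  c * c * (1ℚ + ι (nonempty Bs))        ≡⟨ solve 2 (λ c n → c :* (con 1ℚ :+ n) := (c :+ con 0ℚ) :+ c :* n) refl (c * c) (ι (nonempty Bs)) ⟩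
  c * c + 0ℚ + c * c * ι (nonempty Bs)  ≤⟨ +-mono-≤ (+-monoʳ-≤ (c * c) (area-nonNeg B)) (nonempty-by-area ps) ⟩
  area (s ∷ B) + area (concat Bs)       ≡⟨ area-++ (s ∷ B) ⟨
  area ((s ∷ B) ++ concat Bs)           ∎
  where open ≤-Reasoning

nonempty≤length : ∀ Bs → nonempty Bs ℕ.≤ length Bs
nonempty≤length []             = z≤n
nonempty≤length ([] ∷ Bs)      = ℕ.m≤n⇒m≤1+n (nonempty≤length Bs)
nonempty≤length ((_ ∷ _) ∷ Bs) = s≤s (nonempty≤length Bs)

concat-insert-↭ : ∀ {s : Item} Bs i → concat (Bs [ i ]%= (s ∷_)) ↭ s ∷ concat Bs
concat-insert-↭     (B ∷ Bs) zero    = ↭-refl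
concat-insert-↭ {s} (B ∷ Bs) (suc i) = ↭-trans (++⁺ˡ B (concat-insert-↭ Bs i)) (shift s B (concat Bs))

concat-removeAt-↭ : ∀ (Bs : List Bin) i → concat Bs ↭ lookup Bs i ++ concat (removeAt Bs i)
concat-removeAt-↭ (B ∷ Bs) zero    = ↭-refl
concat-removeAt-↭ (B ∷ Bs) (suc i) = ↭-trans (++⁺ˡ B (concat-removeAt-↭ Bs i)) (begin
  B ++ L ++ R   ↭⟨ ++-assoc B L R ⟨
  (B ++ L) ++ R ↭⟨ ++⁺ʳ R (++-comm B L) ⟩
  (L ++ B) ++ R ↭⟨ ++-assoc L B R ⟩
  L ++ B ++ R   ∎)
  where
  open ↭.PermutationReasoning
  L = lookup Bs i
  R = concat (removeAt Bs i)

concat-remove : ∀ s Bs → concat (map (remove s) Bs) ≡ remove s (concat Bs)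
concat-remove s []       = refl
concat-remove s (B ∷ Bs) = trans (cong (remove s B ++_) (concat-remove s Bs))
  (sym (filter-++ (λ t → ¬? (label t ℕ.≟ label s)) B (concat Bs)))

module _ {Q : Item → Set} where

  insert-All : ∀ {s Bs} i → Q s → All (All Q) Bs → All (All Q) (Bs [ i ]%= (s ∷_))
  insert-All zero    q (qs ∷ qss) = (q ∷ qs) ∷ qss
  insert-All (suc i) q (qs ∷ qss) = qs ∷ insert-All i q qss

  removeAt-All : ∀ {Bs} i → All (All Q) Bs → All (All Q) (removeAt Bs i)
  removeAt-All zero    (_ ∷ qss)  = qss
  removeAt-All (suc i) (qs ∷ qss) = qs ∷ removeAt-All i qss

  remove-All : ∀ s {Bs} → All (All Q) Bs → All (All Q) (map (remove s) Bs)
  remove-All s []        = []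
  remove-All s (qs ∷ qss) = All.filter⁺ (λ t → ¬? (label t ℕ.≟ label s)) qs ∷ remove-All s qss

  lookup-All : ∀ {Bs} i → All (All Q) Bs → All Q (lookup Bs i)
  lookup-All zero    (qs ∷ _)  = qs
  lookup-All (suc i) (_ ∷ qss) = lookup-All i qss

DistinctLabels : List Item → Set
DistinctLabels = AllPairs (λ s t → label s ≢ label t)

same-label : ∀ {P s} → DistinctLabels P → s ∈ P → All (λ t → label t ≡ label s → t ≡ s) P
same-label (s≢ ∷ _) (here refl) = (λ _ → refl) ∷ All.map (λ s≢t eq → contradiction (sym eq) s≢t) s≢
same-label (t≢ ∷ d) (there s∈P) =
  (λ eq → contradiction eq (All.lookup t≢ s∈P)) ∷ same-label d s∈P

-- A departure filters only the bins of one part of SMB, while the list of present squares is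
-- filtered whole. Since labels are distinct, a square with the label of `s` is `s` itself, which
-- the size property `Q` excludes from the other part; filtering there changes nothing.
remove-absent : ∀ {Q : Item → Set} {s xs} → All (λ t → label t ≡ label s → t ≡ s) xs → All Q xs → ¬ Q s →
                remove s xs ≡ xs
remove-absent {s = s} same qs ¬q = filter-all (λ t → ¬? (label t ℕ.≟ label s))
  (All.zipWith (λ { (eq , q) ≡l → ¬q (subst _ (eq ≡l) q) }) (same , qs))

-- The invariant and its preservation.

module _ (m : ℕ) where

  -- The counts include empty bins, so departures leave them unchanged. As the same `m` bounds the
  -- area at all moments, a bound once established persists until a class gains a bin. The additive
  -- constants make room for a bin just opened.
  record Invariant (X : SMBState) (P : List Item) : Set where
    constructor invariant
    open SMBState X
    open SMState sm
    field
      contents  : concat 𝒮 ++ concat ℳ ++ concat ℬ ↭ P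
      distinct  : DistinctLabels P
      𝒮-items   : All (All AtMostHalfItem) 𝒮
      ℳ-items   : All (All (λ s → side s ≡ ½)) ℳ
      ℬ-items   : All (All (λ s → side s ≡ 1ℚ)) ℬ
      𝒮-count   : + 17 / 36 * ι (length 𝒮) ≤ ι m + + 17 / 36
      𝒮ℳ-count  : ι (length 𝒮) + ι (length ℳ) ≤ + 41 / 17 * ι m + + 2 / 1

module _ (m : ℕ) where

  -- The hypothesis is the area bound for the bins as they were before the arrival; the additive
  -- 17/36 pays for the new bin.
  grow-𝒮 : ∀ {n} → + 17 / 36 * ι n ≤ ι m → + 17 / 36 * ι (suc n) ≤ ι m + + 17 / 36
  grow-𝒮 {n} le = subst (λ t → + 17 / 36 * t ≤ ι m + + 17 / 36) (sym (ι-suc n))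
    (p≤p+r (p≤q⇒0≤q-p le)
      (solve 2 (λ m n → con (+ 17 / 36) :* (con 1ℚ :+ n) :+ (m :- con (+ 17 / 36) :* n) := m :+ con (+ 17 / 36)) refl (ι m) (ι n)))

  -- 36/17 times the hypothesis bounds `ι s + + 36 / 17 * ι k`, more than is asked; the other
  -- summands of the slack are the room left in `m`, in `k` and in the constant.
  new-𝒮 : ∀ {s k} → + 17 / 36 * ι s + ι k ≤ ι m → ι (suc s) + ι k ≤ + 41 / 17 * ι m + + 2 / 1
  new-𝒮 {s} {k} le = subst (λ t → t + ι k ≤ + 41 / 17 * ι m + + 2 / 1) (sym (ι-suc s))
    (p≤p+r (+-nonNeg (+-nonNeg (*-nonNeg (≤-dec 0ℚ (+ 36 / 17)) (p≤q⇒0≤q-p le))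
                               (*-nonNeg (≤-dec 0ℚ (+ 5 / 17)) (0≤ι m)))
                     (+-nonNeg (*-nonNeg (≤-dec 0ℚ (+ 19 / 17)) (0≤ι k)) (≤-dec 0ℚ 1ℚ)))
      (solve 3 (λ m s k → ((con 1ℚ :+ s) :+ k)
          :+ ((con (+ 36 / 17) :* (m :- (con (+ 17 / 36) :* s :+ k)) :+ con (+ 5 / 17) :* m)
              :+ (con (+ 19 / 17) :* k :+ con 1ℚ))
        := con (+ 41 / 17) :* m :+ con (+ 2 / 1)) refl (ι m) (ι s) (ι k)))

  -- The constant 41/17 arises here: the second hypothesis gives |𝒮| + |ℳ| ≤ m + (2/3)|𝒮|, and `leS`
  -- bounds (2/3)|𝒮| by (24/17) m + 2/3. With the new bin the constants add up to 5/3, which leaves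
  -- 1/3 of the 2.
  new-ℳ : ∀ {s k} → + 17 / 36 * ι s ≤ ι m + + 17 / 36 → + 1 / 3 * ι s + ι k ≤ ι m →
          ι s + ι (suc k) ≤ + 41 / 17 * ι m + + 2 / 1
  new-ℳ {s} {k} leS le = subst (λ t → ι s + t ≤ + 41 / 17 * ι m + + 2 / 1) (sym (ι-suc k))
    (p≤p+r (+-nonNeg (+-nonNeg (p≤q⇒0≤q-p le) (*-nonNeg (≤-dec 0ℚ (+ 24 / 17)) (p≤q⇒0≤q-p leS)))
                     (≤-dec 0ℚ (+ 1 / 3)))
      (solve 3 (λ m s k → (s :+ (con 1ℚ :+ k))
          :+ (((m :- (con (+ 1 / 3) :* s :+ k))
               :+ con (+ 24 / 17) :* ((m :+ con (+ 17 / 36)) :- con (+ 17 / 36) :* s)) :+ con (+ 1 / 3))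
        := con (+ 41 / 17) :* m :+ con (+ 2 / 1)) refl (ι m) (ι s) (ι k)))

  move-ℳ-𝒮 : ∀ {s k} → ι s + ι (suc k) ≤ + 41 / 17 * ι m + + 2 / 1 →
             ι (suc s) + ι k ≤ + 41 / 17 * ι m + + 2 / 1
  move-ℳ-𝒮 {s} {k} = subst (_≤ + 41 / 17 * ι m + + 2 / 1)
    (trans (cong (_+_ (ι s)) (ι-suc k)) (trans
      (solve 2 (λ s k → s :+ (con 1ℚ :+ k) := (con 1ℚ :+ s) :+ k) refl (ι s) (ι k))
      (cong (_+ ι k) (sym (ι-suc s)))))

  module _ {S M ℬ P} (I : Invariant m (⟨ S , M ⟩ ∣ ℬ) P) (P≤m : area P ≤ ι m) where
    open Invariant I

    area-split : area P ≡ area (concat S) + (area (concat M) + area (concat ℬ))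
    area-split = trans (sym (area-↭ contents))
      (trans (area-++ (concat S)) (cong (_+_ (area (concat S))) (area-++ (concat M))))

    𝒮ℳ-area : area (concat S) + area (concat M) ≤ ι m
    𝒮ℳ-area = ≤-trans (p≤p+r (area-nonNeg (concat ℬ))
      (trans (+-assoc (area (concat S)) _ _) (sym area-split))) P≤m

    𝒮-area : area (concat S) ≤ ι m
    𝒮-area = ≤-trans (p≤p+r (area-nonNeg (concat M)) refl) 𝒮ℳ-area

    ℳ-full : ∀ {s} → side s ≤ ½ → NoFit s M → ι (length M) ≤ area (concat M)
    ℳ-full {s} s≤½ noM = subst (_≤ area (concat M)) (*-identityˡ (ι (length M)))
      (count-by-area (All.zipWith (λ (fails , halves) → rejected-full {s} s≤½ halves fails) (noM , ℳ-items)))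

    𝒮-rejects-small : ∀ {s} → Small s → UnitFraction (side s) → NoFit s S →
                      + 17 / 36 * ι (length S) ≤ area (concat S)
    𝒮-rejects-small {s} small u noS =
      count-by-area (All.zipWith (λ (fails , items) → rejected-small {s} small u items fails) (noS , 𝒮-items))

    𝒮-rejects-medium : ∀ {s} → AtMostHalfItem s → NoFit s S →
                       + 1 / 3 * ι (length S) ≤ area (concat S)
    𝒮-rejects-medium {s} half-s noS =
      count-by-area (All.zipWith (λ (fails , items) → rejected-medium {s} half-s items fails) (noS , 𝒮-items))

    contents-remove : ∀ {s} → remove s (concat S) ++ remove s (concat M) ++ remove s (concat ℬ) ↭ remove s P
    contents-remove {s} = ↭-trans
      (↭-reflexive (trans (cong (remove s (concat S) ++_) (sym (filter-++ keep? (concat M) (concat ℬ))))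
                          (sym (filter-++ keep? (concat S) (concat M ++ concat ℬ)))))
      (filter-↭ keep? contents)
      where keep? = λ t → ¬? (label t ℕ.≟ label s)

    distinct-remove : ∀ {s} → DistinctLabels (remove s P)
    distinct-remove {s} = AllPairs.filter⁺ (λ t → ¬? (label t ℕ.≟ label s)) distinct

    same-label-contents : ∀ {s} → s ∈ P →
                          All (λ t → label t ≡ label s → t ≡ s) (concat S ++ concat M ++ concat ℬ)
    same-label-contents s∈P = All-resp-↭ (↭-sym contents) (same-label distinct s∈P)

    depart-𝒮ℳ : ∀ {s} → ¬ Big s → s ∈ P →
                Invariant m (⟨ map (remove s) S , map (remove s) M ⟩ ∣ ℬ) (remove s P)
    depart-𝒮ℳ {s} ¬big s∈P = record
      { contents = ↭-trans (↭-reflexive (cong₂ _++_ (concat-remove s S)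
          (cong₂ _++_ (concat-remove s M) (sym absent)))) (contents-remove {s})
      ; distinct = distinct-remove {s}
      ; 𝒮-items = remove-All s 𝒮-items
      ; ℳ-items = remove-All s ℳ-items
      ; ℬ-items = ℬ-items
      ; 𝒮-count = subst (λ n → + 17 / 36 * ι n ≤ ι m + + 17 / 36) (sym (length-map (remove s) S)) 𝒮-count
      ; 𝒮ℳ-count = subst₂ (λ n k → ι n + ι k ≤ + 41 / 17 * ι m + + 2 / 1)
          (sym (length-map (remove s) S)) (sym (length-map (remove s) M)) 𝒮ℳ-count
      }
      where
      absent : remove s (concat ℬ) ≡ concat ℬ
      absent = remove-absent (++⁻ʳ (concat M) (++⁻ʳ (concat S) (same-label-contents s∈P)))
        (concat⁺ ℬ-items) (λ ≡1 → ¬big (subst (½ <_) (sym ≡1) (toWitness {a? = ½ <? 1ℚ} tt)))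

    depart-ℬ : ∀ {s} → Big s → s ∈ P → Invariant m (⟨ S , M ⟩ ∣ map (remove s) ℬ) (remove s P)
    depart-ℬ {s} big s∈P = record
      { contents = ↭-trans (↭-reflexive (cong₂ _++_ (sym absent-𝒮)
          (cong₂ _++_ (sym absent-ℳ) (concat-remove s ℬ)))) (contents-remove {s})
      ; distinct = distinct-remove {s}
      ; ℬ-items = remove-All s ℬ-items
      ; 𝒮-items = 𝒮-items
      ; ℳ-items = ℳ-items
      ; 𝒮-count = 𝒮-count
      ; 𝒮ℳ-count = 𝒮ℳ-count
      }
      where
      absent-𝒮 : remove s (concat S) ≡ concat S
      absent-𝒮 = remove-absent (++⁻ˡ (concat S) (same-label-contents s∈P))
        (concat⁺ 𝒮-items) (λ (_ , ≤½) → <-irrefl refl (<-≤-trans big ≤½))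
      absent-ℳ : remove s (concat M) ≡ concat M
      absent-ℳ = remove-absent (++⁻ˡ (concat M) (++⁻ʳ (concat S) (same-label-contents s∈P)))
        (concat⁺ ℳ-items) (λ ≡½ → <-irrefl (sym ≡½) big)

    module _ {s} (fresh : All (λ t → label t ≢ label s) P) (u : UnitFraction (side s)) where

      distinct-insert : DistinctLabels (s ∷ P)
      distinct-insert = All.map (λ ≢ eq → ≢ (sym eq)) fresh ∷ distinct

      contents-𝒮 : ∀ {S′} → concat S′ ↭ s ∷ concat S → concat S′ ++ concat M ++ concat ℬ ↭ s ∷ P
      contents-𝒮 p = ↭-trans (++⁺ʳ _ p) (prep s contents)

      contents-ℳ : ∀ {M′} → concat M′ ↭ s ∷ concat M → concat S ++ concat M′ ++ concat ℬ ↭ s ∷ P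
      contents-ℳ p = ↭-trans (++⁺ˡ (concat S) (++⁺ʳ (concat ℬ) p))
        (↭-trans (shift s (concat S) _) (prep s contents))

      contents-ℬ : ∀ {ℬ′} → concat ℬ′ ↭ s ∷ concat ℬ → concat S ++ concat M ++ concat ℬ′ ↭ s ∷ P
      contents-ℬ p = ↭-trans (++⁺ˡ (concat S) (++⁺ˡ (concat M) p))
        (↭-trans (++⁺ˡ (concat S) (shift s (concat M) (concat ℬ)))
          (↭-trans (shift s (concat S) _) (prep s contents)))

      insert-𝒮 : ∀ i → side s ≤ ½ → Invariant m (⟨ S [ i ]%= (s ∷_) , M ⟩ ∣ ℬ) (s ∷ P)
      insert-𝒮 i s≤½ = record
        { contents = contents-𝒮 {S [ i ]%= (s ∷_)} (concat-insert-↭ S i)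
        ; distinct = distinct-insert
        ; 𝒮-items = insert-All i (u , s≤½) 𝒮-items
        ; 𝒮-count = subst (λ n → + 17 / 36 * ι n ≤ ι m + + 17 / 36) (sym (length-%= S i (s ∷_))) 𝒮-count
        ; 𝒮ℳ-count = subst (λ n → ι n + ι (length M) ≤ + 41 / 17 * ι m + + 2 / 1) (sym (length-%= S i (s ∷_))) 𝒮ℳ-count
        ; ℳ-items = ℳ-items
        ; ℬ-items = ℬ-items
        }

      insert-ℳ : ∀ i → side s ≡ ½ → Invariant m (⟨ S , M [ i ]%= (s ∷_) ⟩ ∣ ℬ) (s ∷ P)
      insert-ℳ i s≡½ = record
        { contents = contents-ℳ {M [ i ]%= (s ∷_)} (concat-insert-↭ M i)
        ; distinct = distinct-insert
        ; ℳ-items = insert-All i s≡½ ℳ-items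
        ; 𝒮ℳ-count = subst (λ n → ι (length S) + ι n ≤ + 41 / 17 * ι m + + 2 / 1) (sym (length-%= M i (s ∷_))) 𝒮ℳ-count
        ; 𝒮-items = 𝒮-items
        ; ℬ-items = ℬ-items
        ; 𝒮-count = 𝒮-count
        }

      insert-ℬ : ∀ i → side s ≡ 1ℚ → Invariant m (⟨ S , M ⟩ ∣ (ℬ [ i ]%= (s ∷_))) (s ∷ P)
      insert-ℬ i s≡1 = record
        { contents = contents-ℬ {ℬ [ i ]%= (s ∷_)} (concat-insert-↭ ℬ i)
        ; distinct = distinct-insert
        ; ℬ-items = insert-All i s≡1 ℬ-items
        ; 𝒮-items = 𝒮-items
        ; ℳ-items = ℳ-items
        ; 𝒮-count = 𝒮-count
        ; 𝒮ℳ-count = 𝒮ℳ-count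
        }

      open-𝒮 : Small s → NoFit s S → NoFit s M → Invariant m (⟨ (s ∷ []) ∷ S , M ⟩ ∣ ℬ) (s ∷ P)
      open-𝒮 small noS noM = record
        { contents = contents-𝒮 {(s ∷ []) ∷ S} ↭-refl
        ; distinct = distinct-insert
        ; 𝒮-items = ((u , s≤½) ∷ []) ∷ 𝒮-items
        ; 𝒮-count = grow-𝒮 {length S} (≤-trans (𝒮-rejects-small {s} small u noS) 𝒮-area)
        ; 𝒮ℳ-count = new-𝒮 {length S} {length M} (≤-trans (+-mono-≤ (𝒮-rejects-small {s} small u noS) (ℳ-full {s} s≤½ noM)) 𝒮ℳ-area)
        ; ℳ-items = ℳ-items
        ; ℬ-items = ℬ-items
        }
        where s≤½ = ≤-trans small (≤-dec (+ 1 / 3) ½)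

      open-ℳ : Medium s → NoFit s M → NoFit s S → Invariant m (⟨ S , (s ∷ []) ∷ M ⟩ ∣ ℬ) (s ∷ P)
      open-ℳ (⅓< , s≤½) noM noS = record
        { contents = contents-ℳ {(s ∷ []) ∷ M} ↭-refl
        ; distinct = distinct-insert
        ; ℳ-items = (medium-is-half u ⅓< s≤½ ∷ []) ∷ ℳ-items
        ; 𝒮ℳ-count = new-ℳ {length S} {length M} 𝒮-count
            (≤-trans (+-mono-≤ (𝒮-rejects-medium {s} (u , s≤½) noS) (ℳ-full {s} s≤½ noM)) 𝒮ℳ-area)
        ; 𝒮-items = 𝒮-items
        ; ℬ-items = ℬ-items
        ; 𝒮-count = 𝒮-count
        }

      open-ℬ : side s ≡ 1ℚ → Invariant m (⟨ S , M ⟩ ∣ ((s ∷ []) ∷ ℬ)) (s ∷ P)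
      open-ℬ s≡1 = record
        { contents = contents-ℬ {(s ∷ []) ∷ ℬ} ↭-refl
        ; distinct = distinct-insert
        ; ℬ-items = (s≡1 ∷ []) ∷ ℬ-items
        ; 𝒮-items = 𝒮-items
        ; ℳ-items = ℳ-items
        ; 𝒮-count = 𝒮-count
        ; 𝒮ℳ-count = 𝒮ℳ-count
        }

      -- All of 𝒮 has rejected the small square, so the bound on 𝒮 is renewed as if a bin were
      -- opened, while the total number of bins stays the same.
      move : ∀ i → Small s → NoFit s S → Invariant m (⟨ (s ∷ lookup M i) ∷ S , removeAt M i ⟩ ∣ ℬ) (s ∷ P)
      move i small noS = record
        { contents = prep s (↭-trans rearrange contents)
        ; distinct = distinct-insert
        -- The index 1 stands for the unit fraction 1/2, as `UnitFraction` counts from `suc 0`.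
        ; 𝒮-items = ((u , s≤½) ∷ All.map (λ ≡½ → (1 , ≡½) , ≤-reflexive ≡½) (lookup-All i ℳ-items)) ∷ 𝒮-items
        ; ℳ-items = removeAt-All i ℳ-items
        ; 𝒮-count = grow-𝒮 {length S} (≤-trans (𝒮-rejects-small {s} small u noS) 𝒮-area)
        ; 𝒮ℳ-count = move-ℳ-𝒮 {length S} {length (removeAt M i)} (subst (λ n → ι (length S) + ι n ≤ + 41 / 17 * ι m + + 2 / 1)
            (length-removeAt′ M i) 𝒮ℳ-count)
        ; ℬ-items = ℬ-items
        }
        where
        s≤½ = ≤-trans small (≤-dec (+ 1 / 3) ½)
        L = lookup M i
        R = concat (removeAt M i)
        open ↭.PermutationReasoning
        rearrange : (L ++ concat S) ++ R ++ concat ℬ ↭ concat S ++ concat M ++ concat ℬ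
        rearrange = begin
          (L ++ concat S) ++ R ++ concat ℬ  ↭⟨ ++⁺ʳ (R ++ concat ℬ) (++-comm L (concat S)) ⟩
          (concat S ++ L) ++ R ++ concat ℬ  ↭⟨ ++-assoc (concat S) L (R ++ concat ℬ) ⟩
          concat S ++ L ++ R ++ concat ℬ    ↭⟨ ++⁺ˡ (concat S) (++-assoc L R (concat ℬ)) ⟨
          concat S ++ (L ++ R) ++ concat ℬ  ↭⟨ ++⁺ˡ (concat S) (++⁺ʳ (concat ℬ) (concat-removeAt-↭ M i)) ⟨
          concat S ++ concat M ++ concat ℬ  ∎

module _ (m : ℕ) where

  step : ∀ {X Y P e σ} → Invariant m X P → area P ≤ ι m → ValidFrom P (e ∷ σ) →
         UnitFraction (side (subject e)) → SMBStep X e Y → Invariant m Y (update P e)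
  step I P≤m (depart s∈P _) u (L₁ ¬big departs) = depart-𝒮ℳ m I P≤m ¬big s∈P
  step I P≤m (depart s∈P _) u (L₂ big departs)  = depart-ℬ m I P≤m big s∈P
  step I P≤m (arrive _ _ fresh _) u (L₁ _ (small-in-S small i _))    = insert-𝒮 m I P≤m fresh u i (≤-trans small (≤-dec (+ 1 / 3) ½))
  step I P≤m (arrive _ _ fresh _) u (L₁ _ (small-in-M small noS i _)) = move m I P≤m fresh u i small noS
  step I P≤m (arrive _ _ fresh _) u (L₁ _ (small-new small noS noM))  = open-𝒮 m I P≤m fresh u small noS noM
  step I P≤m (arrive _ _ fresh _) u (L₁ _ (med-in-M (⅓< , ≤½) i _))   = insert-ℳ m I P≤m fresh u i (medium-is-half u ⅓< ≤½)
  step I P≤m (arrive _ _ fresh _) u (L₁ _ (med-in-S (_ , ≤½) _ i _))  = insert-𝒮 m I P≤m fresh u i ≤½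
  step I P≤m (arrive _ _ fresh _) u (L₁ _ (med-new medium noM noS))   = open-ℳ m I P≤m fresh u medium noM noS
  step I P≤m (arrive _ _ fresh _) u (L₂ big (in-empty i _)) = insert-ℬ m I P≤m fresh u i (big-is-unit u big)
  step I P≤m (arrive _ _ fresh _) u (L₂ big (new _))        = open-ℬ m I P≤m fresh u (big-is-unit u big)

  -- Active bins at one moment and at the peak.

  bound : ℚ
  bound = + 227 / 68 * ι m + + 2 / 1

  active-bound : ∀ {X P} → Invariant m X P → area P ≤ ι m → ι (active X) ≤ bound
  active-bound {⟨ S , M ⟩ ∣ ℬ} {P} I P≤m = begin
    ι (nonempty S ℕ.+ nonempty M ℕ.+ nonempty ℬ)
      ≡⟨ trans (ι-+ (nonempty S ℕ.+ nonempty M) (nonempty ℬ)) (cong (_+ ι (nonempty ℬ)) (ι-+ (nonempty S) (nonempty M))) ⟩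
    ι (nonempty S) + ι (nonempty M) + ι (nonempty ℬ)
      -- The multipliers are 1 for the area of ℳ and ℬ, 9/17 = (1/4)(36/17) for `𝒮-count` and 3/4
      -- for `𝒮ℳ-count`. They give 1 + 9/17 + 123/68 = 227/68, and the constants 1/4 + 3/2 leave 1/4
      -- of the 2.
      ≤⟨ p≤p+r
           (+-nonNeg (+-nonNeg (p≤q⇒0≤q-p (ι-mono-≤ (nonempty≤length S)))
                               (*-nonNeg (≤-dec 0ℚ (+ 3 / 4)) (p≤q⇒0≤q-p (ι-mono-≤ (nonempty≤length M)))))
             (+-nonNeg (+-nonNeg (p≤q⇒0≤q-p ℳℬ-area) (+-nonNeg
                 (*-nonNeg (≤-dec 0ℚ (+ 9 / 17)) (p≤q⇒0≤q-p 𝒮-count)) (*-nonNeg (≤-dec 0ℚ (+ 3 / 4)) (p≤q⇒0≤q-p 𝒮ℳ-count))))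
               (≤-dec 0ℚ (+ 1 / 4))))
           (solve 6 (λ m s s′ k k′ b →
               s′ :+ k′ :+ b
               :+ (((s :- s′) :+ con (+ 3 / 4) :* (k :- k′))
                   :+ (((m :- (con (½ * ½) :* k′ :+ con (1ℚ * 1ℚ) :* b))
                        :+ (con (+ 9 / 17) :* ((m :+ con (+ 17 / 36)) :- con (+ 17 / 36) :* s)
                            :+ con (+ 3 / 4) :* ((con (+ 41 / 17) :* m :+ con (+ 2 / 1)) :- (s :+ k))))
                       :+ con (+ 1 / 4)))
               := con (+ 227 / 68) :* m :+ con (+ 2 / 1)) refl
             (ι m) (ι (length S)) (ι (nonempty S)) (ι (length M)) (ι (nonempty M)) (ι (nonempty ℬ))) ⟩
    bound ∎
    where
    open ≤-Reasoning
    open Invariant I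
    ℳℬ-area : ½ * ½ * ι (nonempty M) + 1ℚ * 1ℚ * ι (nonempty ℬ) ≤ ι m
    ℳℬ-area = ≤-trans (+-mono-≤ (nonempty-by-area ℳ-items) (nonempty-by-area ℬ-items))
      (≤-trans (p≤p+r (area-nonNeg (concat S)) (trans (+-comm (area (concat M) + area (concat ℬ)) (area (concat S))) (sym (area-split m I P≤m)))) P≤m)

  peak-bound : ∀ {X P σ} → Invariant m X P → ValidFrom P σ → UnitFractionInput σ →
               All (λ τ → area (foldl update P τ) ≤ ι m) (inits σ) →
               (r : RunFrom X σ) → ι (peak r) ≤ bound
  peak-bound I _ _ (P≤m ∷ _) [] = active-bound I P≤m
  peak-bound {X} I v (u ∷ us) (P≤m ∷ ≤m) (st ∷ r) with ℕ.⊔-sel (active X) (peak r)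
  ... | inj₁ eq rewrite eq = active-bound I P≤m
  -- The prefixes of `e ∷ σ` are `[]` and the prefixes of `σ` with `e` in front, so `map⁻` yields
  -- the area bounds for a start from `update P e`.
  ... | inj₂ eq rewrite eq = peak-bound (step I P≤m v u st) (rest-valid v) us (map⁻ ≤m) r
    where
    rest-valid : ∀ {P e σ} → ValidFrom P (e ∷ σ) → ValidFrom (update P e) σ
    rest-valid (arrive _ _ _ v) = v
    rest-valid (depart _ v)     = v

-- Comparison with the offline solution.

initial-invariant : ∀ m → Invariant m initial []
initial-invariant m = record
  { contents = ↭-refl ; distinct = [] ; 𝒮-items = [] ; ℳ-items = [] ; ℬ-items = []
  ; 𝒮-count = p≤p+r (+-nonNeg (0≤ι m) (≤-dec 0ℚ (+ 17 / 36))) (+-identityˡ _)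
  ; 𝒮ℳ-count = p≤p+r (+-nonNeg (*-nonNeg (≤-dec 0ℚ (+ 41 / 17)) (0≤ι m)) (≤-dec 0ℚ (+ 2 / 1))) (+-identityˡ _)
  }

present-All : ∀ {Q : Item → Set} {P σ} → All Q P → All (Q ∘ subject) σ →
              All (λ τ → All Q (foldl update P τ)) (inits σ)
present-All qs []                        = qs ∷ []
present-All {σ = arrive s ∷ σ} qs (q ∷ qσ) = qs ∷ All.map⁺ (present-All (q ∷ qs) qσ)
present-All {σ = depart s ∷ σ} qs (_ ∷ qσ) =
  qs ∷ All.map⁺ (present-All (All.filter⁺ (λ t → ¬? (label t ℕ.≟ label s)) qs) qσ)

-- Each packing bounds the area of its moment by its own number of bins, and the offline cost is the
-- maximum of these; so a single number bounds the area throughout, as the invariant requires.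
offline-area : ∀ {τs} → All (All (λ s → 0ℚ ≤ side s) ∘ present) τs → (p : All (Packing ∘ present) τs) →
               All (λ τ → area (present τ) ≤ ι (foldr ℕ._⊔_ 0 (reduce Packing.activeBins p))) τs
offline-area []         []       = []
offline-area (0≤ ∷ 0≤s) (p ∷ ps) =
  ≤-trans (packing-area p 0≤) (ι-mono-≤ (ℕ.m≤m⊔n (Packing.activeBins p) _))
  ∷ All.map (λ le → ≤-trans le (ι-mono-≤ (ℕ.m≤n⊔m (Packing.activeBins p) _))) (offline-area 0≤s ps)

theorem4p8 : ∃[ b ] ((σ : List Event) → Valid σ → UnitFractionInput σ →
    (r : SMBRun σ) (m : ℕ) → IsOPT σ m →
    + peak r / 1 ≤ (+ 4811105 / 1433976) * (+ m / 1) + b)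
theorem4p8 = + 2 / 1 , λ where
  σ v u r m ((p , refl) , _) → ≤-trans
    (peak-bound m (initial-invariant m) v u
      (offline-area (All.map (All.map (<⇒≤ ∘ unitFraction-positive)) (present-All [] u)) p) r)
    -- The ratio obtained is 227/68, about 3.338; it lies below the ratio claimed, which is decided
    -- by computation.
    (+-monoˡ-≤ (+ 2 / 1) (*-monoʳ-≤-nonNeg (ι m) {{normalize-nonNeg m 1}} (≤-dec (+ 227 / 68) (+ 4811105 / 1433976))))
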